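{- As $x\to\infty$, \[M_{\mathrm{id},2,2}(x)= \frac{\zeta(3)}{\zeta(4)}x^2+O(x\log x).\] Moreover, for all fixed integers $b\geq 3$ and $k\ge 2$, as $x\to\infty$, \[M_{\mathrm{id},b,k}(x)=\frac{\zeta(bk-1)}{\zeta(bk)}x^k+O_b\left(x^{k-1}\right).\]
   Context: For integers $b\ge 2$, $k\ge 2$ and positive integers $n_1,\dots,n_k$, the generalized gcd is $(n_1,\dots,n_k)_b:=\max\{d\ge 1: d^b\mid n_1,\dots,d^b\mid n_k\}$. For an arithmetic function $f$, $M_{f,b,k}(x):=\sum_{n_1,\dots,n_k\le x}f((n_1,\dots,n_k)_b)$, the sum running over all $k$-tuples of positive integers at most $x$; $\mathrm{id}$ denotes the identity function $\mathrm{id}(n)=n$, so $M_{\mathrm{id},b,k}(x)=\sum_{n_1,\dots,n_k\le x}(n_1,\dots,n_k)_b$. Here $\zeta$ is the Riemann zeta function and $x$ is a real variable. The integer $k$ is fixed (the implied constant may depend on $k$ as well as on $b$). -}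

module Defs where

open import Data.Integer using (+_)
import Data.Integer as ℤ
import Data.Integer.Properties as ℤ
open import Data.List using (List; []; _∷_; map; upTo; filter; cartesianProductWith)
open import Data.List.Extrema.Nat using (max; ⊥≤max; v≤max⁺; argmax-sel)
open import Data.List.Membership.Propositional.Properties using (∈-filter⁻; ∈-filter⁺; ∈-map⁺; ∈-upTo⁺)
import Data.List.Relation.Unary.Any as Any
open import Data.Nat using (ℕ; zero; suc; NonZero; NonTrivial)
import Data.Nat as ℕ
import Data.Nat.Properties as ℕ
open import Data.Nat.ListAction using (sum)
open import Data.Nat.Divisibility using (_∣_; _∣?_; 1∣_; ∣⇒≤)
open import Data.Product using (∃; _×_; _,_; proj₁; proj₂)
open import Data.Rational using (ℚ; 0ℚ; 1ℚ; ½)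
import Data.Rational as ℚ
import Data.Rational.Properties as ℚ
import Data.Rational.Unnormalised as ℚᵘ
import Data.Rational.Unnormalised.Properties as ℚᵘ
open import Data.Rational.Solver using (module +-*-Solver)
open import Data.Sum using (inj₁; inj₂)
open import Data.Vec using (Vec; []; _∷_)
import Data.Vec as Vec
import Data.Vec.Relation.Unary.All as VecAll
open import Function using (_⇔_; id)
open import Relation.Binary.PropositionalEquality

module Rational where

  open import Data.Rational using (_+_; _*_; _-_; -_; _⊔_; ∣_∣; _≤_; _<_)
  open +-*-Solver using (solve; _:=_; _:+_; _:*_; _:-_; :-_; con)

  ι : ℕ → ℚ
  ι n = + n ℚ./ 1

  ∑ : ℕ → (ℕ → ℚ) → ℚ
  ∑ zero    f = 0ℚ
  ∑ (suc n) f = ∑ n f + f n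

  -- 1 / max(c, t), a total function of t which is 1/t for t ≥ c.
  recip : (c : ℚ) → 0ℚ < c → ℚ → ℚ
  recip c c>0 t = ℚ.1/_ (c ⊔ t) {{ℚ.>-nonZero (ℚ.<-≤-trans c>0 (ℚ.p≤p⊔q c t))}}

  Cauchy : (ℕ → ℚ) → Set
  Cauchy x = ∀ ε → 0ℚ < ε → ∃ λ N → ∀ m n → N ℕ.≤ m → N ℕ.≤ n → ∣ x m - x n ∣ ≤ ε

  0<1 : 0ℚ < 1ℚ
  0<1 = ℚ.*<* (ℤ.+<+ (ℕ.s≤s ℕ.z≤n))

  0<½ : 0ℚ < ½
  0<½ = ℚ.*<* (ℤ.+<+ (ℕ.s≤s ℕ.z≤n))

  *-monoʳ : ∀ {p q r} → 0ℚ ≤ r → p ≤ q → r * p ≤ r * q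
  *-monoʳ {r = r} r≥0 = ℚ.*-monoˡ-≤-nonNeg r {{ℚ.nonNegative r≥0}}

  *-monoˡ : ∀ {p q r} → 0ℚ ≤ r → p ≤ q → p * r ≤ q * r
  *-monoˡ {r = r} r≥0 = ℚ.*-monoʳ-≤-nonNeg r {{ℚ.nonNegative r≥0}}

  *-mono : ∀ {p q r s} → 0ℚ ≤ p → 0ℚ ≤ s → p ≤ q → r ≤ s → p * r ≤ q * s
  *-mono p≥0 s≥0 p≤q r≤s = ℚ.≤-trans (*-monoʳ p≥0 r≤s) (*-monoˡ s≥0 p≤q)

  *-nonNeg : ∀ {p q} → 0ℚ ≤ p → 0ℚ ≤ q → 0ℚ ≤ p * q
  *-nonNeg {p} {q} p≥0 q≥0 = subst (_≤ p * q) (ℚ.*-zeroʳ p) (*-monoʳ p≥0 q≥0)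

  *-pos : ∀ {p q} → 0ℚ < p → 0ℚ < q → 0ℚ < p * q
  *-pos {p} {q} p>0 q>0 =
    subst (_< p * q) (ℚ.*-zeroʳ p) (ℚ.*-monoʳ-<-pos p {{ℚ.positive p>0}} q>0)

  p≤p+q : ∀ {p q} → 0ℚ ≤ q → p ≤ p + q
  p≤p+q {p} {q} q≥0 = subst (_≤ p + q) (ℚ.+-identityʳ p) (ℚ.+-monoʳ-≤ p q≥0)

  p≤q+p : ∀ {p q} → 0ℚ ≤ q → p ≤ q + p
  p≤q+p {p} {q} q≥0 = subst (p ≤_) (ℚ.+-comm p q) (p≤p+q q≥0)

  ∣∣-nonNeg : ∀ p → 0ℚ ≤ ∣ p ∣
  ∣∣-nonNeg p = ℚ.nonNegative⁻¹ ∣ p ∣ {{ℚ.∣-∣-nonNeg p}}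

  p≤∣p∣ : ∀ p → p ≤ ∣ p ∣
  p≤∣p∣ p with ℚ.≤-total 0ℚ p
  ... | inj₁ 0≤p = ℚ.≤-reflexive (sym (ℚ.0≤p⇒∣p∣≡p 0≤p))
  ... | inj₂ p≤0 = ℚ.≤-trans p≤0 (∣∣-nonNeg p)

  ∣-∣-comm : ∀ p q → ∣ p - q ∣ ≡ ∣ q - p ∣
  ∣-∣-comm p q = trans (sym (ℚ.∣-p∣≡∣p∣ (p - q))) (cong ∣_∣ (lem p q))
    where
    lem : ∀ p q → - (p - q) ≡ q - p
    lem = solve 2 (λ p q → :- (p :- q) := q :- p) refl

  ≤⇒-≤ : ∀ {p q d} → p ≤ q + d → p - q ≤ d
  ≤⇒-≤ {p} {q} {d} h = subst (p - q ≤_) (lem q d) (ℚ.+-monoˡ-≤ (- q) h)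
    where
    lem : ∀ q d → q + d - q ≡ d
    lem = solve 2 (λ q d → q :+ d :- q := d) refl

  -≤⇒≤ : ∀ {p q d} → p - q ≤ d → p ≤ q + d
  -≤⇒≤ {p} {q} {d} h = subst (_≤ q + d) (lem p q) (ℚ.+-monoʳ-≤ q h)
    where
    lem : ∀ p q → q + (p - q) ≡ p
    lem = solve 2 (λ p q → q :+ (p :- q) := p) refl

  ∣-∣≤ : ∀ {p q d} → p ≤ q + d → q ≤ p + d → ∣ p - q ∣ ≤ d
  ∣-∣≤ {p} {q} {d} h₁ h₂ with ℚ.∣p∣≡p∨∣p∣≡-p (p - q)
  ... | inj₁ e = subst (_≤ d) (sym e) (≤⇒-≤ h₁)
  ... | inj₂ e = subst (_≤ d) (trans (sym (lem p q)) (sym e)) (≤⇒-≤ h₂)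
    where
    lem : ∀ p q → - (p - q) ≡ q - p
    lem = solve 2 (λ p q → :- (p :- q) := q :- p) refl

  p≤q+∣p-q∣ : ∀ p q → p ≤ q + ∣ p - q ∣
  p≤q+∣p-q∣ p q = -≤⇒≤ (p≤∣p∣ (p - q))

  q≤p+∣p-q∣ : ∀ p q → q ≤ p + ∣ p - q ∣
  q≤p+∣p-q∣ p q = subst (λ d → q ≤ p + d) (∣-∣-comm q p) (p≤q+∣p-q∣ q p)

  ∣-∣-triangle : ∀ p q r → ∣ p - r ∣ ≤ ∣ p - q ∣ + ∣ q - r ∣
  ∣-∣-triangle p q r =
    subst (λ t → ∣ t ∣ ≤ ∣ p - q ∣ + ∣ q - r ∣) (lem p q r) (ℚ.∣p+q∣≤∣p∣+∣q∣ (p - q) (q - r))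
    where
    lem : ∀ p q r → (p - q) + (q - r) ≡ p - r
    lem = solve 3 (λ p q r → (p :- q) :+ (q :- r) := p :- r) refl

  ∣∣-lipschitz : ∀ p q → ∣ ∣ p ∣ - ∣ q ∣ ∣ ≤ ∣ p - q ∣
  ∣∣-lipschitz p q = ∣-∣≤ (half p q) (subst (λ d → ∣ q ∣ ≤ ∣ p ∣ + d) (∣-∣-comm q p) (half q p))
    where
    lem : ∀ p q → q + (p - q) ≡ p
    lem = solve 2 (λ p q → q :+ (p :- q) := p) refl
    half : ∀ p q → ∣ p ∣ ≤ ∣ q ∣ + ∣ p - q ∣
    half p q = subst (λ t → ∣ t ∣ ≤ ∣ q ∣ + ∣ p - q ∣) (lem p q) (ℚ.∣p+q∣≤∣p∣+∣q∣ q (p - q))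

  ⊔-lipschitz : ∀ c p q → ∣ (c ⊔ p) - (c ⊔ q) ∣ ≤ ∣ p - q ∣
  ⊔-lipschitz c p q = ∣-∣≤ (half p q) (subst (λ d → c ⊔ q ≤ (c ⊔ p) + d) (∣-∣-comm q p) (half q p))
    where
    half : ∀ p q → c ⊔ p ≤ (c ⊔ q) + ∣ p - q ∣
    half p q = ℚ.⊔-lub
      (ℚ.≤-trans (ℚ.p≤p⊔q c q) (p≤p+q (∣∣-nonNeg (p - q))))
      (ℚ.≤-trans (p≤q+∣p-q∣ p q) (ℚ.+-monoˡ-≤ ∣ p - q ∣ (ℚ.p≤q⊔p c q)))

  ι-+ : ∀ m n → ι (m ℕ.+ n) ≡ ι m + ι n
  ι-+ m n = ℚ.toℚᵘ-injective (ℚᵘ.≃-trans (ℚ.toℚᵘ-cong (refl {x = ι (m ℕ.+ n)}))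
    (ℚᵘ.≃-trans (ℚ.toℚᵘ-fromℚᵘ (ℚᵘ.mkℚᵘ (+ (m ℕ.+ n)) 0))
    (ℚᵘ.≃-trans (ℚᵘ.*≡* (cong (ℤ._* + 1) (sym (cong₂ ℤ._+_ (ℤ.*-identityʳ (+ m)) (ℤ.*-identityʳ (+ n))))))
    (ℚᵘ.≃-trans (ℚᵘ.+-cong (ℚᵘ.≃-sym (ℚ.toℚᵘ-fromℚᵘ (ℚᵘ.mkℚᵘ (+ m) 0))) (ℚᵘ.≃-sym (ℚ.toℚᵘ-fromℚᵘ (ℚᵘ.mkℚᵘ (+ n) 0))))
      (ℚᵘ.≃-sym (ℚ.toℚᵘ-homo-+ (ι m) (ι n)))))))

  ι-suc : ∀ n → ι (suc n) ≡ ι n + 1ℚ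
  ι-suc n = trans (cong ι (ℕ.+-comm 1 n)) (ι-+ n 1)

  ι-nonNeg : ∀ n → 0ℚ ≤ ι n
  ι-nonNeg zero    = ℚ.≤-refl
  ι-nonNeg (suc n) = subst (0ℚ ≤_) (sym (ι-suc n)) (ℚ.≤-trans (ι-nonNeg n) (p≤p+q (ℚ.<⇒≤ 0<1)))

  inv-≤ : ∀ m n .{{_ : NonZero m}} .{{_ : NonZero n}} → n ℕ.≤ m → + 1 ℚ./ m ≤ + 1 ℚ./ n
  inv-≤ (suc m) (suc n) n≤m = ℚ.toℚᵘ-cancel-≤
    (ℚᵘ.≤-trans (ℚᵘ.≤-reflexive (ℚ.toℚᵘ-fromℚᵘ (ℚᵘ.mkℚᵘ (+ 1) m)))
    (ℚᵘ.≤-trans (ℚᵘ.*≤* (ℤ.*-monoˡ-≤-nonNeg (+ 1) (ℤ.+≤+ n≤m)))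
      (ℚᵘ.≤-reflexive (ℚᵘ.≃-sym (ℚ.toℚᵘ-fromℚᵘ (ℚᵘ.mkℚᵘ (+ 1) n))))))

  inv-nonNeg : ∀ n .{{_ : NonZero n}} → 0ℚ ≤ + 1 ℚ./ n
  inv-nonNeg (suc n) = ℚ.toℚᵘ-cancel-≤
    (ℚᵘ.≤-trans (ℚᵘ.*≤* (ℤ.+≤+ ℕ.z≤n))
      (ℚᵘ.≤-reflexive (ℚᵘ.≃-sym (ℚ.toℚᵘ-fromℚᵘ (ℚᵘ.mkℚᵘ (+ 1) n)))))

  inv-telescope : ∀ n → (+ 1 ℚ./ suc (suc n)) + (+ 1 ℚ./ (suc n ℕ.* suc (suc n))) ≡ + 1 ℚ./ suc n
  inv-telescope n = ℚ.toℚᵘ-injective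
    (ℚᵘ.≃-trans (ℚ.toℚᵘ-homo-+ (+ 1 ℚ./ suc (suc n)) (+ 1 ℚ./ (suc n ℕ.* suc (suc n))))
    (ℚᵘ.≃-trans (ℚᵘ.+-cong (ℚ.toℚᵘ-fromℚᵘ (ℚᵘ.mkℚᵘ (+ 1) (suc n))) (ℚ.toℚᵘ-fromℚᵘ (ℚᵘ.mkℚᵘ (+ 1) (suc n ℕ.+ n ℕ.* suc (suc n)))))
    (ℚᵘ.≃-trans (ℚᵘ.*≡* (cong +_ (lem n)))
      (ℚᵘ.≃-sym (ℚ.toℚᵘ-fromℚᵘ (ℚᵘ.mkℚᵘ (+ 1) n))))))
    where
    open import Data.Nat.Solver using () renaming (module +-*-Solver to S)
    lem : ∀ n → (1 ℕ.* (suc n ℕ.* suc (suc n)) ℕ.+ 1 ℕ.* suc (suc n)) ℕ.* suc n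
              ≡ 1 ℕ.* (suc (suc n) ℕ.* (suc n ℕ.* suc (suc n)))
    lem = S.solve 1 (λ n → let n1 = S.con 1 S.:+ n ; n2 = S.con 2 S.:+ n in
      (S.con 1 S.:* (n1 S.:* n2) S.:+ S.con 1 S.:* n2) S.:* n1
        S.:= S.con 1 S.:* (n2 S.:* (n1 S.:* n2))) refl

  ∣-∣-nonNeg : ∀ {p q} → q ≤ p → ∣ p - q ∣ ≡ p - q
  ∣-∣-nonNeg {p} {q} q≤p =
    ℚ.0≤p⇒∣p∣≡p (subst (_≤ p - q) (ℚ.+-inverseʳ q) (ℚ.+-monoˡ-≤ (- q) q≤p))

  module _ (c : ℚ) (c>0 : 0ℚ < c) where

    ⊔-recip : ∀ t → (c ⊔ t) * recip c c>0 t ≡ 1ℚ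
    ⊔-recip t = ℚ.*-inverseʳ (c ⊔ t) {{ℚ.>-nonZero (ℚ.<-≤-trans c>0 (ℚ.p≤p⊔q c t))}}

    recip-nonNeg : ∀ t → 0ℚ ≤ recip c c>0 t
    recip-nonNeg t = ℚ.<⇒≤ (ℚ.positive⁻¹ _ {{ℚ.1/pos⇒pos (c ⊔ t) {{c⊔t>0}}}})
      where c⊔t>0 = ℚ.positive (ℚ.<-≤-trans c>0 (ℚ.p≤p⊔q c t))

    recip-≤ : ∀ t → recip c c>0 t ≤ recip c c>0 c
    recip-≤ t = subst₂ _≤_ e₁ e₂ (*-monoˡ (recip-nonNeg c) (*-monoˡ (recip-nonNeg t) (ℚ.⊔-mono-≤ (ℚ.≤-refl {c}) c≤c⊔t)))
      where
      c≤c⊔t = ℚ.p≤p⊔q c t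
      e₁ : (c ⊔ c) * recip c c>0 t * recip c c>0 c ≡ recip c c>0 t
      e₁ = trans (lem (c ⊔ c) (recip c c>0 t) (recip c c>0 c))
             (trans (cong (_* recip c c>0 t) (⊔-recip c)) (ℚ.*-identityˡ _))
        where
        lem : ∀ a r s → a * r * s ≡ (a * s) * r
        lem = solve 3 (λ a r s → a :* r :* s := (a :* s) :* r) refl
      e₂ : (c ⊔ (c ⊔ t)) * recip c c>0 t * recip c c>0 c ≡ recip c c>0 c
      e₂ = trans (cong (λ z → z * recip c c>0 t * recip c c>0 c)
                   (trans (sym (ℚ.⊔-assoc c c t)) (cong (_⊔ t) (ℚ.⊔-idem c))))
             (trans (cong (_* recip c c>0 c) (⊔-recip t)) (ℚ.*-identityˡ _))

    recip-lipschitz : ∀ s t → ∣ recip c c>0 s - recip c c>0 t ∣ ≤ recip c c>0 c * recip c c>0 c * ∣ s - t ∣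
    recip-lipschitz s t = subst (_≤ R * R * ∣ s - t ∣) (sym e)
      (*-mono (*-nonNeg (recip-nonNeg s) (recip-nonNeg t)) (∣∣-nonNeg (s - t))
        (*-mono (recip-nonNeg s) (recip-nonNeg c) (recip-≤ s) (recip-≤ t))
        (subst (_≤ ∣ s - t ∣) (∣-∣-comm (c ⊔ s) (c ⊔ t)) (⊔-lipschitz c s t)))
      where
      R = recip c c>0 c
      r = recip c c>0 s
      r′ = recip c c>0 t
      lem : ∀ a b r r′ → r * r′ * (b - a) ≡ r * (b * r′) - r′ * (a * r)
      lem = solve 4 (λ a b r r′ → r :* r′ :* (b :- a) := r :* (b :* r′) :- r′ :* (a :* r)) refl
      e : ∣ r - r′ ∣ ≡ r * r′ * ∣ (c ⊔ t) - (c ⊔ s) ∣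
      e = trans (cong ∣_∣ (sym (trans (lem (c ⊔ s) (c ⊔ t) r r′)
              (trans (cong₂ (λ u v → r * u - r′ * v) (⊔-recip t) (⊔-recip s))
                (cong₂ _-_ (ℚ.*-identityʳ r) (ℚ.*-identityʳ r′))))))
            (trans (ℚ.∣p*q∣≡∣p∣*∣q∣ (r * r′) ((c ⊔ t) - (c ⊔ s)))
              (cong (_* ∣ (c ⊔ t) - (c ⊔ s) ∣) (ℚ.0≤p⇒∣p∣≡p (*-nonNeg (recip-nonNeg s) (recip-nonNeg t)))))

  cauchy-by : ∀ x y z → Cauchy x → Cauchy y → ∀ K N → 0ℚ < K →
              (∀ m n → N ℕ.≤ m → N ℕ.≤ n → ∣ z m - z n ∣ ≤ K * (∣ x m - x n ∣ + ∣ y m - y n ∣)) →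
              Cauchy z
  cauchy-by x y z cx cy K N K>0 h ε ε>0 = N ℕ.⊔ (Nx ℕ.⊔ Ny) , close
    where
    R = recip K K>0 K
    K*R : K * R ≡ 1ℚ
    K*R = trans (cong (_* R) (sym (ℚ.⊔-idem K))) (⊔-recip K K>0 K)
    R>0 : 0ℚ < R
    R>0 = ℚ.positive⁻¹ R {{ℚ.1/pos⇒pos (K ℚ.⊔ K) {{ℚ.positive (ℚ.<-≤-trans K>0 (ℚ.p≤p⊔q K K))}}}}
    δ = R * (½ * ε)
    δ>0 : 0ℚ < δ
    δ>0 = *-pos R>0 (*-pos 0<½ ε>0)
    Nx = proj₁ (cx δ δ>0)
    Ny = proj₁ (cy δ δ>0)
    lem : ∀ k r e → k * (r * (½ * e) + r * (½ * e)) ≡ (k * r) * e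
    lem = solve 3 (λ k r e → k :* (r :* (con ½ :* e) :+ r :* (con ½ :* e)) := (k :* r) :* e) refl
    close : ∀ m n → N ℕ.⊔ (Nx ℕ.⊔ Ny) ℕ.≤ m → N ℕ.⊔ (Nx ℕ.⊔ Ny) ℕ.≤ n → ∣ z m - z n ∣ ≤ ε
    close m n m≥ n≥ = ℚ.≤-trans
      (h m n (ℕ.m⊔n≤o⇒m≤o N _ m≥) (ℕ.m⊔n≤o⇒m≤o N _ n≥))
      (ℚ.≤-trans
        (*-monoʳ (ℚ.<⇒≤ K>0) (ℚ.+-mono-≤
          (proj₂ (cx δ δ>0) m n (ℕ.m⊔n≤o⇒m≤o Nx Ny (ℕ.m⊔n≤o⇒n≤o N _ m≥)) (ℕ.m⊔n≤o⇒m≤o Nx Ny (ℕ.m⊔n≤o⇒n≤o N _ n≥)))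
          (proj₂ (cy δ δ>0) m n (ℕ.m⊔n≤o⇒n≤o Nx Ny (ℕ.m⊔n≤o⇒n≤o N _ m≥)) (ℕ.m⊔n≤o⇒n≤o Nx Ny (ℕ.m⊔n≤o⇒n≤o N _ n≥)))))
        (ℚ.≤-reflexive (trans (lem K R ε) (trans (cong (_* ε) K*R) (ℚ.*-identityˡ ε)))))

  cauchy-lipschitz : ∀ x z → Cauchy x → ∀ K → 0ℚ < K →
                     (∀ m n → ∣ z m - z n ∣ ≤ K * ∣ x m - x n ∣) → Cauchy z
  cauchy-lipschitz x z cx K K>0 h = cauchy-by x x z cx cx K 0 K>0 (λ m n _ _ →
    ℚ.≤-trans (h m n) (*-monoʳ (ℚ.<⇒≤ K>0) (p≤p+q (∣∣-nonNeg (x m - x n)))))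

  cauchy-const : ∀ q → Cauchy (λ _ → q)
  cauchy-const q ε ε>0 = 0 , λ _ _ _ _ →
    subst (λ t → ∣ t ∣ ≤ ε) (sym (ℚ.+-inverseʳ q)) (ℚ.<⇒≤ ε>0)

  cauchy-neg : ∀ x → Cauchy x → Cauchy (λ n → - x n)
  cauchy-neg x cx = cauchy-lipschitz x (λ n → - x n) cx 1ℚ 0<1 (λ m n → ℚ.≤-reflexive
    (trans (cong ∣_∣ (lem (x m) (x n))) (trans (ℚ.∣-p∣≡∣p∣ (x m - x n)) (sym (ℚ.*-identityˡ _)))))
    where
    lem : ∀ p q → - p - - q ≡ - (p - q)
    lem = solve 2 (λ p q → :- p :- :- q := :- (p :- q)) refl

  cauchy-abs : ∀ x → Cauchy x → Cauchy (λ n → ∣ x n ∣)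
  cauchy-abs x cx = cauchy-lipschitz x (λ n → ∣ x n ∣) cx 1ℚ 0<1 (λ m n →
    ℚ.≤-trans (∣∣-lipschitz (x m) (x n)) (ℚ.≤-reflexive (sym (ℚ.*-identityˡ _))))

  cauchy-⊔ : ∀ x c → Cauchy x → Cauchy (λ n → c ⊔ x n)
  cauchy-⊔ x c cx = cauchy-lipschitz x (λ n → c ⊔ x n) cx 1ℚ 0<1 (λ m n →
    ℚ.≤-trans (⊔-lipschitz c (x m) (x n)) (ℚ.≤-reflexive (sym (ℚ.*-identityˡ _))))

  cauchy-+ : ∀ x y → Cauchy x → Cauchy y → Cauchy (λ n → x n + y n)
  cauchy-+ x y cx cy = cauchy-by x y (λ n → x n + y n) cx cy 1ℚ 0 0<1 (λ m n _ _ →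
    subst₂ _≤_ (cong ∣_∣ (lem (x m) (x n) (y m) (y n))) (sym (ℚ.*-identityˡ _))
      (ℚ.∣p+q∣≤∣p∣+∣q∣ (x m - x n) (y m - y n)))
    where
    lem : ∀ a b c d → (a - b) + (c - d) ≡ (a + c) - (b + d)
    lem = solve 4 (λ a b c d → (a :- b) :+ (c :- d) := (a :+ c) :- (b :+ d)) refl

  bounded : ∀ x → Cauchy x → ∃ λ B → 0ℚ < B × ∃ λ N → ∀ n → N ℕ.≤ n → ∣ x n ∣ ≤ B
  bounded x cx = ∣ x N ∣ + 1ℚ
                 , ℚ.<-≤-trans 0<1 (p≤q+p (∣∣-nonNeg (x N)))
                 , N
                 , λ n n≥N → ℚ.≤-trans
                     (subst (λ t → ∣ t ∣ ≤ ∣ x N ∣ + ∣ x n - x N ∣) (lem (x n) (x N)) (ℚ.∣p+q∣≤∣p∣+∣q∣ (x N) (x n - x N)))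
                     (ℚ.+-monoʳ-≤ ∣ x N ∣ (proj₂ (cx 1ℚ 0<1) n N n≥N ℕ.≤-refl))
    where
    N = proj₁ (cx 1ℚ 0<1)
    lem : ∀ p q → q + (p - q) ≡ p
    lem = solve 2 (λ p q → q :+ (p :- q) := p) refl

  cauchy-* : ∀ x y → Cauchy x → Cauchy y → Cauchy (λ n → x n * y n)
  cauchy-* x y cx cy = cauchy-by x y (λ n → x n * y n) cx cy (B + C) (N ℕ.⊔ M) B+C>0 close
    where
    B = proj₁ (bounded x cx)
    C = proj₁ (bounded y cy)
    B>0 = proj₁ (proj₂ (bounded x cx))
    C>0 = proj₁ (proj₂ (bounded y cy))
    N = proj₁ (proj₂ (proj₂ (bounded x cx)))
    M = proj₁ (proj₂ (proj₂ (bounded y cy)))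
    x≤B = proj₂ (proj₂ (proj₂ (bounded x cx)))
    y≤C = proj₂ (proj₂ (proj₂ (bounded y cy)))
    B+C>0 : 0ℚ < B + C
    B+C>0 = ℚ.<-≤-trans B>0 (p≤p+q (ℚ.<⇒≤ C>0))
    lem : ∀ a b c d → a * (c - d) + d * (a - b) ≡ a * c - b * d
    lem = solve 4 (λ a b c d → a :* (c :- d) :+ d :* (a :- b) := a :* c :- b :* d) refl
    expand : ∀ b c s t → (b * t + c * s) + (b * s + c * t) ≡ (b + c) * (s + t)
    expand = solve 4 (λ b c s t → (b :* t :+ c :* s) :+ (b :* s :+ c :* t) := (b :+ c) :* (s :+ t)) refl
    bilinear : ∀ a b c d β γ → ∣ a ∣ ≤ β → ∣ d ∣ ≤ γ → 0ℚ ≤ β → 0ℚ ≤ γ →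
               ∣ a * c - b * d ∣ ≤ (β + γ) * (∣ a - b ∣ + ∣ c - d ∣)
    bilinear a b c d β γ a≤β d≤γ β≥0 γ≥0 = ℚ.≤-trans
      (subst₂ _≤_ (cong ∣_∣ (lem a b c d))
        (cong₂ _+_ (ℚ.∣p*q∣≡∣p∣*∣q∣ a (c - d)) (ℚ.∣p*q∣≡∣p∣*∣q∣ d (a - b)))
        (ℚ.∣p+q∣≤∣p∣+∣q∣ (a * (c - d)) (d * (a - b))))
      (ℚ.≤-trans
        (ℚ.+-mono-≤ (*-monoˡ (∣∣-nonNeg (c - d)) a≤β) (*-monoˡ (∣∣-nonNeg (a - b)) d≤γ))
        (subst (β * ∣ c - d ∣ + γ * ∣ a - b ∣ ≤_)
          (expand β γ ∣ a - b ∣ ∣ c - d ∣)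
          (p≤p+q (ℚ.+-mono-≤ (*-nonNeg β≥0 (∣∣-nonNeg (a - b))) (*-nonNeg γ≥0 (∣∣-nonNeg (c - d)))))))
    close : ∀ m n → N ℕ.⊔ M ℕ.≤ m → N ℕ.⊔ M ℕ.≤ n →
            ∣ x m * y m - x n * y n ∣ ≤ (B + C) * (∣ x m - x n ∣ + ∣ y m - y n ∣)
    close m n m≥ n≥ = bilinear (x m) (x n) (y m) (y n) B C
      (x≤B m (ℕ.m⊔n≤o⇒m≤o N M m≥)) (y≤C n (ℕ.m⊔n≤o⇒n≤o N M n≥)) (ℚ.<⇒≤ B>0) (ℚ.<⇒≤ C>0)

  cauchy-recip : ∀ x c (c>0 : 0ℚ < c) → Cauchy x → Cauchy (λ n → recip c c>0 (x n))
  cauchy-recip x c c>0 cx = cauchy-lipschitz x (λ n → recip c c>0 (x n)) cx (R * R) (*-pos R>0 R>0)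
    (λ m n → recip-lipschitz c c>0 (x m) (x n))
    where
    R = recip c c>0 c
    R>0 : 0ℚ < R
    R>0 = ℚ.positive⁻¹ R {{ℚ.1/pos⇒pos (c ⊔ c) {{ℚ.positive (ℚ.<-≤-trans c>0 (ℚ.p≤p⊔q c c))}}}}

  module _ {y z : ℕ → ℚ} (K : ℚ)
           (step : ∀ n → ∣ z (suc n) - z n ∣ ≤ K * (y n - y (suc n))) where

    steps : ∀ k n → ∣ z (k ℕ.+ n) - z n ∣ ≤ K * (y n - y (k ℕ.+ n))
    steps zero n = ℚ.≤-reflexive (trans (cong ∣_∣ (ℚ.+-inverseʳ (z n)))
      (sym (trans (cong (K *_) (ℚ.+-inverseʳ (y n))) (ℚ.*-zeroʳ K))))
    steps (suc k) n = ℚ.≤-trans (∣-∣-triangle (z (suc k ℕ.+ n)) (z (k ℕ.+ n)) (z n))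
      (subst (∣ z (suc k ℕ.+ n) - z (k ℕ.+ n) ∣ + ∣ z (k ℕ.+ n) - z n ∣ ≤_)
        (lem K (y (k ℕ.+ n)) (y (suc k ℕ.+ n)) (y n))
        (ℚ.+-mono-≤ (step (k ℕ.+ n)) (steps k n)))
      where
      lem : ∀ K a b c → K * (a - b) + K * (c - a) ≡ K * (c - b)
      lem = solve 4 (λ K a b c → K :* (a :- b) :+ K :* (c :- a) := K :* (c :- b)) refl

    steps-≤ : 0ℚ ≤ K → ∀ m n → ∣ z m - z n ∣ ≤ K * ∣ y m - y n ∣
    steps-≤ K≥0 m n with ℕ.≤-total n m
    ... | inj₁ n≤m = ℚ.≤-trans
          (subst (λ m → ∣ z m - z n ∣ ≤ K * (y n - y m)) (ℕ.m∸n+n≡m n≤m) (steps (m ℕ.∸ n) n))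
          (*-monoʳ K≥0 (subst (y n - y m ≤_) (∣-∣-comm (y n) (y m)) (p≤∣p∣ (y n - y m))))
    ... | inj₂ m≤n = ℚ.≤-trans
          (subst₂ _≤_ (∣-∣-comm (z n) (z m)) refl
            (subst (λ n → ∣ z n - z m ∣ ≤ K * (y m - y n)) (ℕ.m∸n+n≡m m≤n) (steps (n ℕ.∸ m) m)))
          (*-monoʳ K≥0 (p≤∣p∣ (y m - y n)))

  archimedean : ∀ ε → 0ℚ < ε → ∃ λ N → + 1 ℚ./ suc N ≤ ε
  archimedean ε@(ℚ.mkℚ (+ suc p) d _) _ = d , ℚ.toℚᵘ-cancel-≤
    (ℚᵘ.≤-trans (ℚᵘ.≤-reflexive (ℚ.toℚᵘ-fromℚᵘ (ℚᵘ.mkℚᵘ (+ 1) d)))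
      (ℚᵘ.*≤* (ℤ.*-monoʳ-≤-nonNeg (+ suc d) (ℤ.+≤+ (ℕ.s≤s (ℕ.z≤n {p}))))))
  archimedean (ℚ.mkℚ (+ zero)  d _) (ℚ.*<* (ℤ.+<+ ()))
  archimedean (ℚ.mkℚ ℤ.-[1+ p ] d _) (ℚ.*<* ())

  cauchy-null : ∀ y → (∀ n → 0ℚ ≤ y n) → (∀ n → y n ≤ + 1 ℚ./ suc n) → Cauchy y
  cauchy-null y y≥0 y≤ ε ε>0 with archimedean ε ε>0
  ... | N , 1/N≤ε = N , λ m n m≥N n≥N → ∣-∣≤
        (ℚ.≤-trans (small m m≥N) (p≤q+p (y≥0 n)))
        (ℚ.≤-trans (small n n≥N) (p≤q+p (y≥0 m)))
    where
    small : ∀ m → N ℕ.≤ m → y m ≤ ε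
    small m m≥N = ℚ.≤-trans (y≤ m) (ℚ.≤-trans (inv-≤ (suc m) (suc N) (ℕ.s≤s m≥N)) 1/N≤ε)

  ∑-≥0 : ∀ n {f} → (∀ i → 0ℚ ≤ f i) → 0ℚ ≤ ∑ n f
  ∑-≥0 zero    f≥0 = ℚ.≤-refl
  ∑-≥0 (suc n) f≥0 = ℚ.≤-trans (∑-≥0 n f≥0) (p≤p+q (f≥0 n))

  ∑-lipschitz : ∀ n {f g} d → (∀ i → ∣ f i - g i ∣ ≤ d) → ∣ ∑ n f - ∑ n g ∣ ≤ ι n * d
  ∑-lipschitz zero    {f} {g} d h = ℚ.≤-reflexive (sym (ℚ.*-zeroˡ d))
  ∑-lipschitz (suc n) {f} {g} d h = subst₂ _≤_ (cong ∣_∣ (lem (∑ n f) (f n) (∑ n g) (g n)))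
      (trans (lem′ (ι n) d) (cong (_* d) (sym (ι-suc n))))
      (ℚ.≤-trans (ℚ.∣p+q∣≤∣p∣+∣q∣ (∑ n f - ∑ n g) (f n - g n))
        (ℚ.+-mono-≤ (∑-lipschitz n {f} {g} d h) (h n)))
    where
    lem : ∀ a b c d → (a - c) + (b - d) ≡ (a + b) - (c + d)
    lem = solve 4 (λ a b c d → (a :- c) :+ (b :- d) := (a :+ b) :- (c :+ d)) refl
    lem′ : ∀ k d → k * d + d ≡ (k + 1ℚ) * d
    lem′ = solve 2 (λ k d → k :* d :+ d := (k :+ con 1ℚ) :* d) refl

  ∑-double : ∀ n f → ∑ (n ℕ.+ n) f ≡ ∑ n (λ i → f (i ℕ.+ i) + f (suc (i ℕ.+ i)))
  ∑-double zero    f = refl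
  ∑-double (suc n) f = trans (cong (λ k → ∑ k f) (cong suc (ℕ.+-suc n n)))
    (trans (ℚ.+-assoc (∑ (n ℕ.+ n) f) (f (n ℕ.+ n)) (f (suc (n ℕ.+ n))))
      (cong (_+ (f (n ℕ.+ n) + f (suc (n ℕ.+ n)))) (∑-double n f)))

  zetaTerm : ℕ → ℕ → ℚ
  zetaTerm s i = ℚ._/_ (+ 1) (suc i ℕ.^ s) {{ℕ.m^n≢0 (suc i) s}}

  zetaTerm-nonNeg : ∀ s i → 0ℚ ≤ zetaTerm s i
  zetaTerm-nonNeg s i = inv-nonNeg (suc i ℕ.^ s) {{ℕ.m^n≢0 (suc i) s}}

  zetaTerm-≤ : ∀ s → 2 ℕ.≤ s → ∀ n →
               zetaTerm s (suc n) ≤ (+ 1 ℚ./ suc n) - (+ 1 ℚ./ suc (suc n))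
  zetaTerm-≤ s 2≤s n = subst (zetaTerm s (suc n) ≤_) e
    (inv-≤ (suc (suc n) ℕ.^ s) (suc n ℕ.* suc (suc n)) {{ℕ.m^n≢0 (suc (suc n)) s}} bound)
    where
    bound : suc n ℕ.* suc (suc n) ℕ.≤ suc (suc n) ℕ.^ s
    bound = ℕ.≤-trans (ℕ.*-mono-≤ (ℕ.n≤1+n (suc n)) (ℕ.≤-reflexive (sym (ℕ.*-identityʳ (suc (suc n))))))
                      (ℕ.^-monoʳ-≤ (suc (suc n)) 2≤s)
    lem : ∀ a b → b ≡ a + b - a
    lem = solve 2 (λ a b → b := a :+ b :- a) refl
    e : + 1 ℚ./ (suc n ℕ.* suc (suc n)) ≡ (+ 1 ℚ./ suc n) - (+ 1 ℚ./ suc (suc n))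
    e = trans (lem (+ 1 ℚ./ suc (suc n)) _) (cong (_- (+ 1 ℚ./ suc (suc n))) (inv-telescope n))

  cauchy-zeta : ∀ s → 2 ℕ.≤ s → Cauchy (λ n → ∑ (suc n) (zetaTerm s))
  cauchy-zeta s 2≤s = cauchy-lipschitz (λ n → + 1 ℚ./ suc n) (λ n → ∑ (suc n) (zetaTerm s))
    (cauchy-null (λ n → + 1 ℚ./ suc n) (λ n → inv-nonNeg (suc n)) (λ _ → ℚ.≤-refl)) 1ℚ 0<1
    (steps-≤ {y = λ n → + 1 ℚ./ suc n} {z = λ n → ∑ (suc n) (zetaTerm s)} 1ℚ step (ℚ.<⇒≤ 0<1))
    where
    lem : ∀ a b → b ≡ a + b - a
    lem = solve 2 (λ a b → b := a :+ b :- a) refl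
    step : ∀ n → ∣ ∑ (suc (suc n)) (zetaTerm s) - ∑ (suc n) (zetaTerm s) ∣
               ≤ 1ℚ * ((+ 1 ℚ./ suc n) - (+ 1 ℚ./ suc (suc n)))
    step n = subst₂ _≤_
      (trans (sym (ℚ.0≤p⇒∣p∣≡p (zetaTerm-nonNeg s (suc n)))) (cong ∣_∣ (lem (∑ (suc n) (zetaTerm s)) _)))
      (sym (ℚ.*-identityˡ _))
      (zetaTerm-≤ s 2≤s n)

  zeta-≥1 : ∀ s n → 1ℚ ≤ ∑ (suc n) (zetaTerm s)
  zeta-≥1 s zero    = ℚ.≤-trans (ℚ.≤-reflexive (sym one)) (p≤q+p ℚ.≤-refl)
    where
    one : zetaTerm s 0 ≡ 1ℚ
    one = trans (inv-cong (1 ℕ.^ s) 1 {{ℕ.m^n≢0 1 s}} (ℕ.^-zeroˡ s)) refl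
      where
      inv-cong : ∀ m n .{{_ : NonZero m}} .{{_ : NonZero n}} → m ≡ n → + 1 ℚ./ m ≡ + 1 ℚ./ n
      inv-cong m .m refl = refl
  zeta-≥1 s (suc n) = ℚ.≤-trans (zeta-≥1 s n) (p≤p+q (zetaTerm-nonNeg s (suc n)))

  ½^_ : ℕ → ℚ
  ½^ zero  = 1ℚ
  ½^ suc n = ½ * ½^ n

  ½^-nonNeg : ∀ n → 0ℚ ≤ ½^ n
  ½^-nonNeg zero    = ℚ.<⇒≤ 0<1
  ½^-nonNeg (suc n) = *-nonNeg (ℚ.<⇒≤ 0<½) (½^-nonNeg n)

  ½-double : ∀ p → p ≡ ½ * p + ½ * p
  ½-double = solve 1 (λ p → p := con ½ :* p :+ con ½ :* p) refl

  ½^-≤ : ∀ n → ½^ n ≤ + 1 ℚ./ suc n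
  ½^-≤ zero    = ℚ.≤-refl
  ½^-≤ (suc n) = ℚ.≤-trans (*-monoʳ (ℚ.<⇒≤ 0<½) (½^-≤ n)) halve
    where
    a = + 1 ℚ./ suc n
    b = + 1 ℚ./ suc (suc n)
    c = + 1 ℚ./ (suc n ℕ.* suc (suc n))
    c≤b : c ≤ b
    c≤b = inv-≤ (suc n ℕ.* suc (suc n)) (suc (suc n)) (ℕ.m≤n*m (suc (suc n)) (suc n))
    halve : ½ * a ≤ b
    halve = subst₂ _≤_ (cong (½ *_) (inv-telescope n))
      (trans (ℚ.*-distribˡ-+ ½ b b) (sym (½-double b)))
      (*-monoʳ (ℚ.<⇒≤ 0<½) (ℚ.+-monoʳ-≤ b c≤b))

  2^*½^ : ∀ n → ι (2 ℕ.^ n) * ½^ n ≡ 1ℚ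
  2^*½^ zero    = refl
  2^*½^ (suc n) = trans (cong (λ k → ι k * (½ * ½^ n)) (cong (2 ℕ.^ n ℕ.+_) (ℕ.+-identityʳ (2 ℕ.^ n))))
    (trans (cong (_* (½ * ½^ n)) (ι-+ (2 ℕ.^ n) (2 ℕ.^ n)))
      (trans (lem (ι (2 ℕ.^ n)) (½^ n)) (2^*½^ n)))
    where
    lem : ∀ a b → (a + a) * (½ * b) ≡ a * b
    lem = solve 2 (λ a b → (a :+ a) :* (con ½ :* b) := a :* b) refl

  -- The left Riemann sum of ∫ dt/t from 1 to 1 + N h, with step h.
  riemann : ℕ → ℚ → ℚ
  riemann N h = ∑ N (λ i → h * recip 1ℚ 0<1 (1ℚ + ι i * h))

  private
    r : ℚ → ℚ
    r = recip 1ℚ 0<1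

    r≤1 : ∀ t → r t ≤ 1ℚ
    r≤1 = recip-≤ 1ℚ 0<1

    r≥0 : ∀ t → 0ℚ ≤ r t
    r≥0 = recip-nonNeg 1ℚ 0<1

    r-inv : ∀ t → 1ℚ ≤ t → t * r t ≡ 1ℚ
    r-inv t 1≤t = trans (cong (_* r t) (sym (ℚ.p≤q⇒p⊔q≡q 1≤t))) (⊔-recip 1ℚ 0<1 t)

    rr≤ : ∀ s t {d} → 0ℚ ≤ d → r s * r t * d ≤ d
    rr≤ s t {d} d≥0 = subst (r s * r t * d ≤_) (ℚ.*-identityˡ d)
      (*-monoˡ d≥0 (*-mono {q = 1ℚ} {s = 1ℚ} (r≥0 s) (ℚ.<⇒≤ 0<1) (r≤1 s) (r≤1 t)))

    1≤node : ∀ i {h} → 0ℚ ≤ h → 1ℚ ≤ 1ℚ + ι i * h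
    1≤node i h≥0 = p≤p+q (*-nonNeg (ι-nonNeg i) h≥0)

    term-lipschitz : ∀ i h h′ → 0ℚ ≤ h → 0ℚ ≤ h′ →
      ∣ h * r (1ℚ + ι i * h) - h′ * r (1ℚ + ι i * h′) ∣ ≤ ∣ h - h′ ∣
    term-lipschitz i h h′ h≥0 h′≥0 = subst (_≤ ∣ h - h′ ∣) (sym e) (rr≤ t t′ (∣∣-nonNeg (h - h′)))
      where
      t = 1ℚ + ι i * h
      t′ = 1ℚ + ι i * h′
      lem : ∀ k h h′ a b → a * b * (h - h′) ≡ h * a * ((1ℚ + k * h′) * b) - h′ * b * ((1ℚ + k * h) * a)
      lem = solve 5 (λ k h h′ a b → a :* b :* (h :- h′) :=
        h :* a :* ((con 1ℚ :+ k :* h′) :* b) :- h′ :* b :* ((con 1ℚ :+ k :* h) :* a)) refl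
      e₀ : r t * r t′ * (h - h′) ≡ h * r t - h′ * r t′
      e₀ = trans (lem (ι i) h h′ (r t) (r t′))
        (cong₂ _-_
          (trans (cong (h * r t *_) (r-inv t′ (1≤node i h′≥0))) (ℚ.*-identityʳ (h * r t)))
          (trans (cong (h′ * r t′ *_) (r-inv t (1≤node i h≥0))) (ℚ.*-identityʳ (h′ * r t′))))
      e : ∣ h * r t - h′ * r t′ ∣ ≡ r t * r t′ * ∣ h - h′ ∣
      e = trans (cong ∣_∣ (sym e₀)) (trans (ℚ.∣p*q∣≡∣p∣*∣q∣ (r t * r t′) (h - h′))
            (cong (_* ∣ h - h′ ∣) (ℚ.0≤p⇒∣p∣≡p (*-nonNeg (r≥0 t) (r≥0 t′)))))

    -- Splitting the step [t, t + 2g] at its midpoint t + g.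
    split-≤ : ∀ t g → 1ℚ ≤ t → 0ℚ ≤ g → ∣ (g * r t + g * r (t + g)) - (g + g) * r t ∣ ≤ g * g
    split-≤ t g 1≤t g≥0 = subst (_≤ g * g) (sym e) (rr≤ t (t + g) (*-nonNeg g≥0 g≥0))
      where
      lem : ∀ t g a b → (g * a + g * b) - (g + g) * a ≡ g * b * (1ℚ - t * a) - g * a * (1ℚ - (t + g) * b) - a * b * (g * g)
      lem = solve 4 (λ t g a b → (g :* a :+ g :* b) :- (g :+ g) :* a :=
        g :* b :* (con 1ℚ :- t :* a) :- g :* a :* (con 1ℚ :- (t :+ g) :* b) :- a :* b :* (g :* g)) refl
      lem₂ : ∀ x y z → x * (1ℚ - 1ℚ) - y * (1ℚ - 1ℚ) - z ≡ - z
      lem₂ = solve 3 (λ x y z → x :* (con 1ℚ :- con 1ℚ) :- y :* (con 1ℚ :- con 1ℚ) :- z := :- z) refl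
      e₀ : (g * r t + g * r (t + g)) - (g + g) * r t ≡ - (r t * r (t + g) * (g * g))
      e₀ = trans (lem t g (r t) (r (t + g)))
        (trans (cong₂ (λ u v → g * r (t + g) * (1ℚ - u) - g * r t * (1ℚ - v) - r t * r (t + g) * (g * g))
                 (r-inv t 1≤t) (r-inv (t + g) (ℚ.≤-trans 1≤t (p≤p+q g≥0))))
          (lem₂ (g * r (t + g)) (g * r t) (r t * r (t + g) * (g * g))))
      e : ∣ (g * r t + g * r (t + g)) - (g + g) * r t ∣ ≡ r t * r (t + g) * (g * g)
      e = trans (cong ∣_∣ e₀) (trans (ℚ.∣-p∣≡∣p∣ _)
            (ℚ.0≤p⇒∣p∣≡p (*-nonNeg (*-nonNeg (r≥0 t) (r≥0 (t + g))) (*-nonNeg g≥0 g≥0))))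

  riemann-lipschitz : ∀ N h h′ → 0ℚ ≤ h → 0ℚ ≤ h′ → ∣ riemann N h - riemann N h′ ∣ ≤ ι N * ∣ h - h′ ∣
  riemann-lipschitz N h h′ h≥0 h′≥0 = ∑-lipschitz N ∣ h - h′ ∣ (λ i → term-lipschitz i h h′ h≥0 h′≥0)

  riemann-refine : ∀ N g → 0ℚ ≤ g → ∣ riemann (N ℕ.+ N) g - riemann N (g + g) ∣ ≤ ι N * (g * g)
  riemann-refine N g g≥0 = subst (λ z → ∣ z - riemann N (g + g) ∣ ≤ ι N * (g * g))
    (sym (∑-double N (λ i → g * r (1ℚ + ι i * g))))
    (∑-lipschitz N (g * g) pair)
    where
    node : ∀ i → 1ℚ + ι i * (g + g) ≡ 1ℚ + ι (i ℕ.+ i) * g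
    node i = cong (λ z → 1ℚ + z) (trans (lem (ι i) g) (cong (_* g) (sym (ι-+ i i))))
      where
      lem : ∀ k g → k * (g + g) ≡ (k + k) * g
      lem = solve 2 (λ k g → k :* (g :+ g) := (k :+ k) :* g) refl
    next : ∀ j → 1ℚ + ι j * g + g ≡ 1ℚ + ι (suc j) * g
    next j = trans (lem (ι j) g) (cong (λ k → 1ℚ + k * g) (sym (ι-suc j)))
      where
      lem : ∀ k g → 1ℚ + k * g + g ≡ 1ℚ + (k + 1ℚ) * g
      lem = solve 2 (λ k g → con 1ℚ :+ k :* g :+ g := con 1ℚ :+ (k :+ con 1ℚ) :* g) refl
    pair : ∀ i → ∣ (g * r (1ℚ + ι (i ℕ.+ i) * g) + g * r (1ℚ + ι (suc (i ℕ.+ i)) * g))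
                   - (g + g) * r (1ℚ + ι i * (g + g)) ∣ ≤ g * g
    pair i = subst₂ (λ t t′ → ∣ (g * r (1ℚ + ι (i ℕ.+ i) * g) + g * r t′) - (g + g) * r t ∣ ≤ g * g)
      (sym (node i)) (next (i ℕ.+ i))
      (split-≤ (1ℚ + ι (i ℕ.+ i) * g) g (1≤node (i ℕ.+ i) g≥0) g≥0)

  logSum : ℕ → ℚ → ℚ
  logSum n u = riemann (2 ℕ.^ n) (u * ½^ n)

  logSum-lipschitz : ∀ n u v → 0ℚ ≤ u → 0ℚ ≤ v → ∣ logSum n u - logSum n v ∣ ≤ ∣ u - v ∣
  logSum-lipschitz n u v u≥0 v≥0 = subst (∣ logSum n u - logSum n v ∣ ≤_) e
    (riemann-lipschitz (2 ℕ.^ n) (u * ½^ n) (v * ½^ n) (*-nonNeg u≥0 (½^-nonNeg n)) (*-nonNeg v≥0 (½^-nonNeg n)))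
    where
    lem : ∀ u v p → u * p - v * p ≡ (u - v) * p
    lem = solve 3 (λ u v p → u :* p :- v :* p := (u :- v) :* p) refl
    lem₂ : ∀ k d p → k * (d * p) ≡ d * (k * p)
    lem₂ = solve 3 (λ k d p → k :* (d :* p) := d :* (k :* p)) refl
    e : ι (2 ℕ.^ n) * ∣ u * ½^ n - v * ½^ n ∣ ≡ ∣ u - v ∣
    e = trans (cong (ι (2 ℕ.^ n) *_) (trans (cong ∣_∣ (lem u v (½^ n)))
          (trans (ℚ.∣p*q∣≡∣p∣*∣q∣ (u - v) (½^ n)) (cong (∣ u - v ∣ *_) (ℚ.0≤p⇒∣p∣≡p (½^-nonNeg n))))))
        (trans (lem₂ (ι (2 ℕ.^ n)) ∣ u - v ∣ (½^ n))
          (trans (cong (∣ u - v ∣ *_) (2^*½^ n)) (ℚ.*-identityʳ _)))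

  logSum-step : ∀ u → 0ℚ ≤ u → ∀ n → ∣ logSum (suc n) u - logSum n u ∣ ≤ u * u * (½^ n - ½^ suc n)
  logSum-step u u≥0 n = ℚ.≤-trans
    (subst₂ (λ k h → ∣ riemann k g - riemann N h ∣ ≤ ι N * (g * g))
      (cong (N ℕ.+_) (sym (ℕ.+-identityʳ N))) (sym (double u p))
      (riemann-refine N g g≥0))
    (subst₂ _≤_ (sym e) (e₂ (u * u) p) (p≤p+q (*-nonNeg (*-nonNeg u≥0 u≥0) q≥0)))
    where
    N = 2 ℕ.^ n
    p = ½^ n
    g = u * (½ * p)
    q = ½ * (½ * p)
    g≥0 : 0ℚ ≤ g
    g≥0 = *-nonNeg u≥0 (½^-nonNeg (suc n))
    q≥0 : 0ℚ ≤ q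
    q≥0 = *-nonNeg (ℚ.<⇒≤ 0<½) (½^-nonNeg (suc n))
    double : ∀ u p → u * p ≡ u * (½ * p) + u * (½ * p)
    double = solve 2 (λ u p → u :* p := u :* (con ½ :* p) :+ u :* (con ½ :* p)) refl
    lem : ∀ k u p → k * (u * (½ * p) * (u * (½ * p))) ≡ (k * p) * (u * u * (½ * (½ * p)))
    lem = solve 3 (λ k u p → k :* (u :* (con ½ :* p) :* (u :* (con ½ :* p)))
                      := (k :* p) :* (u :* u :* (con ½ :* (con ½ :* p)))) refl
    e : ι N * (g * g) ≡ u * u * q
    e = trans (lem (ι N) u p) (trans (cong (_* (u * u * q)) (2^*½^ n)) (ℚ.*-identityˡ _))
    e₂ : ∀ w p → w * (½ * (½ * p)) + w * (½ * (½ * p)) ≡ w * (p - ½ * p)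
    e₂ = solve 2 (λ w p → w :* (con ½ :* (con ½ :* p)) :+ w :* (con ½ :* (con ½ :* p)) := w :* (p :- con ½ :* p)) refl

  cauchy-logSum : ∀ u → (∀ n → 0ℚ ≤ u n) → Cauchy u → Cauchy (λ n → logSum n (u n))
  cauchy-logSum u u≥0 cu = cauchy-by u ½^_ (λ n → logSum n (u n)) cu
    (cauchy-null ½^_ ½^-nonNeg ½^-≤) K N K>0 close
    where
    B = proj₁ (bounded u cu)
    N = proj₁ (proj₂ (proj₂ (bounded u cu)))
    u≤B = proj₂ (proj₂ (proj₂ (bounded u cu)))
    B≥0 : 0ℚ ≤ B
    B≥0 = ℚ.<⇒≤ (proj₁ (proj₂ (bounded u cu)))
    K = 1ℚ + B * B
    K>0 : 0ℚ < K
    K>0 = ℚ.<-≤-trans 0<1 (p≤p+q (*-nonNeg B≥0 B≥0))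
    expand : ∀ w a b → (a + w * b) + (b + w * a) ≡ (1ℚ + w) * (a + b)
    expand = solve 3 (λ w a b → (a :+ w :* b) :+ (b :+ w :* a) := (con 1ℚ :+ w) :* (a :+ b)) refl
    combine : ∀ β m n x y → 0ℚ ≤ x → 0ℚ ≤ y → ∣ y ∣ ≤ β → 0ℚ ≤ β →
      ∣ logSum m x - logSum n y ∣ ≤ (1ℚ + β * β) * (∣ x - y ∣ + ∣ ½^ m - ½^ n ∣)
    combine β m n x y x≥0 y≥0 y≤β β≥0 = ℚ.≤-trans (∣-∣-triangle (logSum m x) (logSum m y) (logSum n y))
      (ℚ.≤-trans (ℚ.+-mono-≤ (logSum-lipschitz m x y x≥0 y≥0)
          (ℚ.≤-trans (steps-≤ {y = ½^_} {z = λ k → logSum k y} (y * y) (logSum-step y y≥0) (*-nonNeg y≥0 y≥0) m n)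
            (*-monoˡ b≥0 (*-mono y≥0 β≥0 y≤ y≤))))
        (subst (a + β * β * b ≤_) (expand (β * β) a b) (p≤p+q (ℚ.+-mono-≤ b≥0 (*-nonNeg (*-nonNeg β≥0 β≥0) a≥0)))))
      where
      a = ∣ x - y ∣
      b = ∣ ½^ m - ½^ n ∣
      a≥0 = ∣∣-nonNeg (x - y)
      b≥0 = ∣∣-nonNeg (½^ m - ½^ n)
      y≤ = ℚ.≤-trans (p≤∣p∣ y) y≤β
    close : ∀ m n → N ℕ.≤ m → N ℕ.≤ n →
      ∣ logSum m (u m) - logSum n (u n) ∣ ≤ K * (∣ u m - u n ∣ + ∣ ½^ m - ½^ n ∣)
    close m n _ n≥N = combine B m n (u m) (u n) (u≥0 m) (u≥0 n) (u≤B n n≥N) B≥0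

-- The real numbers, as Cauchy sequences of rationals with a modulus of convergence.
record ℝ : Set where
  constructor mkℝ
  field
    seq    : ℕ → ℚ
    cauchy : Rational.Cauchy seq
open ℝ public

infix  4 _≤_
infixl 6 _+_ _-_
infixl 7 _*_ _/_ _/ζ_
infixr 8 _^_

fromℚ : ℚ → ℝ
fromℚ q = mkℝ (λ _ → q) (Rational.cauchy-const q)

fromℕ : ℕ → ℝ
fromℕ n = fromℚ (Rational.ι n)

_≤_ : ℝ → ℝ → Set
x ≤ y = ∀ ε → 0ℚ ℚ.< ε → ∃ λ N → ∀ n → N ℕ.≤ n → seq x n ℚ.≤ seq y n ℚ.+ ε

_+_ : ℝ → ℝ → ℝ
x + y = mkℝ (λ n → seq x n ℚ.+ seq y n) (Rational.cauchy-+ (seq x) (seq y) (cauchy x) (cauchy y))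

-_ : ℝ → ℝ
- x = mkℝ (λ n → ℚ.- seq x n) (Rational.cauchy-neg (seq x) (cauchy x))

_-_ : ℝ → ℝ → ℝ
x - y = x + (- y)

_*_ : ℝ → ℝ → ℝ
x * y = mkℝ (λ n → seq x n ℚ.* seq y n) (Rational.cauchy-* (seq x) (seq y) (cauchy x) (cauchy y))

∣_∣ : ℝ → ℝ
∣ x ∣ = mkℝ (λ n → ℚ.∣ seq x n ∣) (Rational.cauchy-abs (seq x) (cauchy x))

_^_ : ℝ → ℕ → ℝ
x ^ zero  = fromℕ 1
x ^ suc n = x * x ^ n

record Positive (y : ℝ) : Set where
  field
    bound      : ℚ
    bound>0    : 0ℚ ℚ.< bound
    from       : ℕ
    eventually : ∀ n → from ℕ.≤ n → bound ℚ.≤ seq y n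

-- Positivity of y supplies a rational c > 0 with yₙ ≥ c for all large n, so
-- that the sequence 1 / max(c, yₙ) represents 1 / y.
_/_ : ℝ → (y : ℝ) → {{Positive y}} → ℝ
_/_ x y {{y>0}} = x * mkℝ (λ n → Rational.recip bound bound>0 (seq y n))
                          (Rational.cauchy-recip (seq y) bound bound>0 (cauchy y))
  where open Positive y>0

-- The Riemann zeta function at the integers s ≥ 2, as the limit of its partial
-- sums 1/1ˢ + 1/2ˢ + ⋯ + 1/(n+1)ˢ.
ζ : (s : ℕ) .{{_ : NonTrivial s}} → ℝ
ζ s = mkℝ (λ n → Rational.∑ (suc n) (Rational.zetaTerm s))
          (Rational.cauchy-zeta s (ℕ.nonTrivial⇒n>1 s))

ζ-positive : ∀ s .{{_ : NonTrivial s}} → Positive (ζ s)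
ζ-positive s = record
  { bound = 1ℚ ; bound>0 = Rational.0<1 ; from = 0 ; eventually = λ n _ → Rational.zeta-≥1 s n }

_/ζ_ : ℝ → (s : ℕ) .{{_ : NonTrivial s}} → ℝ
x /ζ s = _/_ x (ζ s) {{ζ-positive s}}

-- The natural logarithm on [1, ∞), as the integral of dt/t from 1 to x: the limit
-- of left Riemann sums over 2ⁿ equal subintervals.  For x < 1 the upper limit of
-- integration is replaced by 1, so log x is 0 there; only its values for large x
-- are ever relevant.
log : ℝ → ℝ
log x = mkℝ (λ n → Rational.logSum n (u n))
            (Rational.cauchy-logSum u (λ n → ℚ.p≤p⊔q 0ℚ (seq x n ℚ.- 1ℚ))
              (Rational.cauchy-⊔ (seq (x - fromℕ 1)) 0ℚ (cauchy (x - fromℕ 1))))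
  where
  u : ℕ → ℚ
  u n = 0ℚ ℚ.⊔ (seq x n ℚ.- 1ℚ)

[1⋯_] : ℕ → List ℕ
[1⋯ N ] = map suc (upTo N)

CommonPowerDivisor : ∀ {k} → ℕ → ℕ → Vec ℕ k → Set
CommonPowerDivisor b d ns = VecAll.All (λ n → d ℕ.^ b ∣ n) ns

-- (n₁, …, n_k)_b.  When b ≥ 1, k ≥ 1 and all nᵢ ≥ 1, every d ≥ 1 with d ^ b dividing
-- all nᵢ is at most n₁ + ⋯ + n_k, and d = 1 is one.
powerGcd : ∀ {k} → ℕ → Vec ℕ k → ℕ
powerGcd b ns = max 1 (filter (λ d → VecAll.all? (λ n → d ℕ.^ b ∣? n) ns) [1⋯ Vec.sum ns ])

powerGcd-isMax : ∀ {k} b (ns : Vec ℕ (suc k)) → 1 ℕ.≤ b → VecAll.All (1 ℕ.≤_) ns →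
  (1 ℕ.≤ powerGcd b ns × CommonPowerDivisor b (powerGcd b ns) ns) ×
  (∀ d → 1 ℕ.≤ d → CommonPowerDivisor b d ns → d ℕ.≤ powerGcd b ns)
powerGcd-isMax {k} b ns@(n ∷ _) 1≤b (1≤n VecAll.∷ _) = (⊥≤max 1 candidates , divides-max) , maximal
  where
  divides? = λ d → VecAll.all? (λ n → d ℕ.^ b ∣? n) ns
  candidates = filter divides? [1⋯ Vec.sum ns ]
  1-divides : CommonPowerDivisor b 1 ns
  1-divides = VecAll.universal (λ n → subst (_∣ n) (sym (ℕ.^-zeroˡ b)) (1∣ n)) ns
  divides-max : CommonPowerDivisor b (powerGcd b ns) ns
  divides-max with argmax-sel id 1 candidates
  ... | inj₁ e = subst (λ d → CommonPowerDivisor b d ns) (sym e) 1-divides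
  ... | inj₂ m = proj₂ (∈-filter⁻ divides? {xs = [1⋯ Vec.sum ns ]} m)
  bound : ∀ d → 1 ℕ.≤ d → CommonPowerDivisor b d ns → d ℕ.≤ Vec.sum ns
  bound d 1≤d (d^b∣n VecAll.∷ _) = ℕ.≤-trans
    (subst (ℕ._≤ d ℕ.^ b) (ℕ.^-identityʳ d) (ℕ.^-monoʳ-≤ d {{ℕ.>-nonZero 1≤d}} 1≤b))
    (ℕ.≤-trans (∣⇒≤ {{ℕ.>-nonZero 1≤n}} d^b∣n) (ℕ.m≤m+n n _))
  maximal : ∀ d → 1 ℕ.≤ d → CommonPowerDivisor b d ns → d ℕ.≤ powerGcd b ns
  maximal zero    ()
  maximal (suc d) 1≤d dv = v≤max⁺ 1 candidates
    (inj₂ (Any.map ℕ.≤-reflexive (∈-filter⁺ divides? (∈-map⁺ suc (∈-upTo⁺ (bound (suc d) 1≤d dv))) dv)))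

tuples : (k N : ℕ) → List (Vec ℕ k)
tuples zero    N = [] ∷ []
tuples (suc k) N = cartesianProductWith _∷_ [1⋯ N ] (tuples k N)

-- M_{f,b,k}(x), where N is the number of positive integers n ≤ x.
M : (ℕ → ℕ) → (b k N : ℕ) → ℕ
M f b k N = sum (map (λ ns → f (powerGcd b ns)) (tuples k N))

-- N = ⌊x⌋.  A relation rather than a function, since the floor of a real number
-- is not computable.
_IsFloorOf_ : ℕ → ℝ → Set
N IsFloorOf x = ∀ n → (n ℕ.≤ N) ⇔ (fromℕ n ≤ x)

-- S(⌊x⌋) = F(x) + O(G(x)) as x → ∞.
_∘floor≈_+O_ : (ℕ → ℕ) → (ℝ → ℝ) → (ℝ → ℝ) → Set
S ∘floor≈ F +O G =
  ∃ λ (C : ℝ) → ∃ λ (x₀ : ℝ) → ∀ x N → N IsFloorOf x → x₀ ≤ x →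
    ∣ fromℕ (S N) - F x ∣ ≤ C * ∣ G x ∣

bk∸1-nonTrivial : ∀ {b k} → 3 ℕ.≤ b → 2 ℕ.≤ k → NonTrivial (b ℕ.* k ℕ.∸ 1)
bk∸1-nonTrivial 3≤b 2≤k = ℕ.n>1⇒nonTrivial (ℕ.≤-trans (ℕ.m≤m+n 2 3) (ℕ.∸-monoˡ-≤ 1 (ℕ.*-mono-≤ 3≤b 2≤k)))

bk-nonTrivial : ∀ {b k} → 3 ℕ.≤ b → 2 ℕ.≤ k → NonTrivial (b ℕ.* k)
bk-nonTrivial 3≤b 2≤k = ℕ.n>1⇒nonTrivial (ℕ.≤-trans (ℕ.m≤m+n 2 4) (ℕ.*-mono-≤ 3≤b 2≤k))

module Submission where

-- Write E(N) for the error term M(N) - c Nᵏ with c = ζ(bk - 1) / ζ(bk).  No Möbius inversion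
-- is needed: every vector ns contributes ∑_{d ∣ (ns)_b} d to both sides of
--     ∑_m M(⌊N / mᵇ⌋) = ∑_m m ⌊N / mᵇ⌋ᵏ,
-- so that ∑_m E(⌊N / mᵇ⌋) = ∑_m (m - c) ⌊N / mᵇ⌋ᵏ.  Since c ζ(bk) = ζ(bk - 1), removing the
-- floors changes the right-hand side to 0 up to the desired error, and as ∑_{m ≥ 2} 1 / m² < 1 a
-- strong induction on N bounds E(N) itself.  All of this is done with the rational partial sums
-- of the two zeta values in place of c, uniformly in their length n ≥ N.

import Defs

-- A real is a rational sequence and `_≤_` compares terms up to every ε, so it is enough to bound
-- the n-th terms for all large n. The n-th term of ζ(bk - 1) / ζ(bk) is a quotient c of partial
-- sums over m ≤ n + 1. For this c the cancellation is exact, so no tail of a zeta series is ever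
-- estimated. The price is uniformity in n: the sums over m may run far beyond N, and no bound may
-- depend on n. Removing the floor in ⌊N / mᵇ⌋ᵏ costs at most k (N / mᵇ)^(k-1). Weighted by m this
-- decays like m^(1 - b(k-1)): summable for b ≥ 3, harmonic for b = k = 2, which is where the
-- logarithm comes from. The induction needs ∑_{m ≥ 2} 1 / m² strictly below 1, whereas telescoping
-- 1 / (m - 1) - 1 / m from m = 2 gives only 1. Telescoping from m = 3 gives 1/4 + 1/2 = 3/4, and 4
-- = 1 / (1 - 3/4) is the factor lost in the induction.

module Counting where

  open import Data.Bool using (if_then_else_)
  open import Data.List using ([]; _∷_; _++_; map; upTo; cartesianProductWith)
  open import Data.List.Properties using (map-++; map-∘; upTo-∷ʳ)
  open import Data.Nat
  open import Data.Nat.Coprimality using (Coprime; coprime-divisor; GCD≡1⇒coprime)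
  open import Data.Nat.Divisibility
  open import Data.Nat.DivMod using (_/_; m/n*n≤m; m/n≤m; m≡m%n+[m/n]*n; m%n<n)
  open import Data.Nat.GCD using (gcd; gcd[m,n]∣m; gcd[m,n]∣n; GCD-/gcd; gcd[m,n]≡0⇒m≡0)
  import Data.Nat.Coprimality as Coprimality
  open import Data.Nat.ListAction using (sum)
  open import Data.Nat.ListAction.Properties using (sum-++)
  open import Data.Nat.LCM using (lcm; m∣lcm[m,n]; n∣lcm[m,n]; gcd*lcm)
  open import Data.Nat.Properties
  open import Data.Nat.Solver using (module +-*-Solver)
  open import Data.Product using (_×_; _,_; proj₁; proj₂)
  open import Data.Sum using (inj₁; inj₂)
  open import Data.Vec using (Vec; []; _∷_)
  import Data.Vec as Vec
  open import Data.Vec.Relation.Unary.All using (All; []; _∷_; all?)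
  import Data.Vec.Relation.Unary.All as All
  open import Function using (_∘_; id)
  open import Relation.Binary.PropositionalEquality
  open import Relation.Nullary
  open Defs using (tuples; [1⋯_]; M; powerGcd; powerGcd-isMax; CommonPowerDivisor)
  open +-*-Solver using (solve; _:=_; _:+_; _:*_)

  -- Finite sums, indicators and sums over multiples.

  ∑ : ℕ → (ℕ → ℕ) → ℕ
  ∑ zero    f = 0
  ∑ (suc n) f = ∑ n f + f n

  ∑-cong : ∀ n {f g} → (∀ i → i < n → f i ≡ g i) → ∑ n f ≡ ∑ n g
  ∑-cong zero    h = refl
  ∑-cong (suc n) h = cong₂ _+_ (∑-cong n (λ i i<n → h i (m<n⇒m<1+n i<n))) (h n ≤-refl)

  ∑-zero : ∀ n → ∑ n (λ _ → 0) ≡ 0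
  ∑-zero zero    = refl
  ∑-zero (suc n) = trans (+-identityʳ _) (∑-zero n)

  ∑-const : ∀ n c → ∑ n (λ _ → c) ≡ n * c
  ∑-const zero    c = refl
  ∑-const (suc n) c = trans (cong (_+ c) (∑-const n c)) (+-comm (n * c) c)

  ∑-+ : ∀ n f g → ∑ n (λ i → f i + g i) ≡ ∑ n f + ∑ n g
  ∑-+ zero    f g = refl
  ∑-+ (suc n) f g = trans (cong (_+ (f n + g n)) (∑-+ n f g))
    (solve 4 (λ a b c d → (a :+ b) :+ (c :+ d) := (a :+ c) :+ (b :+ d)) refl (∑ n f) (∑ n g) (f n) (g n))

  ∑-*ˡ : ∀ n c f → ∑ n (λ i → c * f i) ≡ c * ∑ n f
  ∑-*ˡ zero    c f = sym (*-zeroʳ c)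
  ∑-*ˡ (suc n) c f = trans (cong (_+ c * f n) (∑-*ˡ n c f)) (sym (*-distribˡ-+ c (∑ n f) (f n)))

  ∑-swap : ∀ m n (f : ℕ → ℕ → ℕ) → ∑ m (λ i → ∑ n (f i)) ≡ ∑ n (λ j → ∑ m (λ i → f i j))
  ∑-swap zero    n f = sym (∑-zero n)
  ∑-swap (suc m) n f = trans (cong (_+ ∑ n (f m)) (∑-swap m n f)) (sym (∑-+ n _ (f m)))

  𝟙 : ∀ {a} {A : Set a} → Dec A → ℕ
  𝟙 d = if does d then 1 else 0

  𝟙-true : ∀ {a} {A : Set a} (d : Dec A) → A → 𝟙 d ≡ 1
  𝟙-true (yes _) _ = refl
  𝟙-true (no ¬a) a = contradiction a ¬a

  𝟙-false : ∀ {a} {A : Set a} (d : Dec A) → ¬ A → 𝟙 d ≡ 0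
  𝟙-false (yes a) ¬a = contradiction a ¬a
  𝟙-false (no _)  _  = refl

  𝟙-absorb : ∀ {a b} {A : Set a} {B : Set b} (d : Dec A) (e : Dec B) → (B → A) → 𝟙 d * 𝟙 e ≡ 𝟙 e
  𝟙-absorb d (yes b) f = trans (cong (_* 1) (𝟙-true d (f b))) refl
  𝟙-absorb d (no _)  f = *-zeroʳ (𝟙 d)

  ∑-pick : ∀ n {a} (P : ℕ → Set a) (P? : ∀ i → Dec (P i)) (f : ℕ → ℕ) i → i < n → P i →
           (∀ j → P j → j ≡ i) → ∑ n (λ j → 𝟙 (P? j) * f j) ≡ f i
  ∑-pick (suc n) P P? f i i<1+n Pi unique with m≤n⇒m<n∨m≡n (s≤s⁻¹ i<1+n)
  ... | inj₂ refl = cong₂ _+_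
        (trans (∑-cong n (λ j j<n → cong (_* f j) (𝟙-false (P? j) (λ Pj → <⇒≢ j<n (unique j Pj))))) (∑-zero n))
        (trans (cong (_* f i) (𝟙-true (P? i) Pi)) (*-identityˡ (f i)))
  ... | inj₁ i<n = trans (cong₂ _+_ (∑-pick n P P? f i i<n Pi unique)
          (cong (_* f n) (𝟙-false (P? n) (λ Pn → <⇒≢ i<n (sym (unique n Pn))))))
        (+-identityʳ (f i))

  -- The two inequalities pin `a` down as ⌊N / q⌋ without division, so that induction on `N` only
  -- has to ask whether `suc N` is the next multiple of `q`.
  ∑-multiples : ∀ q .{{_ : NonZero q}} N a (f : ℕ → ℕ) → q * a ≤ N → N < q * suc a →
                ∑ a (λ j → f (q * suc j)) ≡ ∑ N (λ i → 𝟙 (q ∣? suc i) * f (suc i))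
  ∑-multiples q zero zero f _ _ = refl
  ∑-multiples q@(suc _) zero (suc a) f () _
  ∑-multiples q (suc N) a f qa≤ <qa with q ∣? suc N
  ... | no q∤ = trans (∑-multiples q N a f
            (s≤s⁻¹ (≤∧≢⇒< qa≤ (λ e → q∤ (divides a (trans (sym e) (*-comm q a))))))
            (<-trans (n<1+n N) <qa))
          (sym (+-identityʳ _))
  ... | yes (divides c e) with a | ≤-antisym
          (*-cancelˡ-≤ q (subst (q * a ≤_) (trans e (*-comm c q)) qa≤))
          (s≤s⁻¹ (*-cancelˡ-< q c (suc a) (subst (_< q * suc a) (trans e (*-comm c q)) <qa)))
  ...   | zero   | refl = contradiction e λ ()
  ...   | suc a′ | refl = cong₂ _+_
            (∑-multiples q N a′ f
              (s≤s⁻¹ (subst (q * a′ <_) (sym e′) (*-monoʳ-< q (n<1+n a′))))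
              (subst (N <_) e′ (n<1+n N)))
            (trans (cong f (sym e′)) (sym (*-identityˡ _)))
    where
    e′ : suc N ≡ q * suc a′
    e′ = trans e (*-comm (suc a′) q)

  ∑-/ : ∀ q .{{_ : NonZero q}} N (f : ℕ → ℕ) →
        ∑ (N / q) (λ j → f (q * suc j)) ≡ ∑ N (λ i → 𝟙 (q ∣? suc i) * f (suc i))
  ∑-/ q N f = ∑-multiples q N (N / q) f
    (subst (_≤ N) (*-comm (N / q) q) (m/n*n≤m N q))
    (subst₂ _<_ (sym (m≡m%n+[m/n]*n N q)) (*-comm (suc (N / q)) q) (+-monoˡ-< (N / q * q) (m%n<n N q)))

  -- Sums over tuples and their rescaling.

  ∑ᵛ : ∀ k → ℕ → (Vec ℕ k → ℕ) → ℕ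
  ∑ᵛ zero    N F = F []
  ∑ᵛ (suc k) N F = ∑ N (λ i → ∑ᵛ k N (λ ns → F (suc i ∷ ns)))

  sum-[1⋯] : ∀ N (f : ℕ → ℕ) → sum (map f [1⋯ N ]) ≡ ∑ N (λ i → f (suc i))
  sum-[1⋯] zero    f = refl
  sum-[1⋯] (suc N) f = begin
    sum (map f (map suc (upTo (suc N))))                   ≡⟨ cong (sum ∘ map f ∘ map suc) (upTo-∷ʳ N) ⟨
    sum (map f (map suc (upTo N ++ N ∷ [])))               ≡⟨ cong (sum ∘ map f) (map-++ suc (upTo N) _) ⟩
    sum (map f ([1⋯ N ] ++ suc N ∷ []))                    ≡⟨ cong sum (map-++ f [1⋯ N ] _) ⟩
    sum (map f [1⋯ N ] ++ f (suc N) ∷ [])                  ≡⟨ sum-++ (map f [1⋯ N ]) _ ⟩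
    sum (map f [1⋯ N ]) + (f (suc N) + 0)                  ≡⟨ cong₂ _+_ (sum-[1⋯] N f) (+-identityʳ _) ⟩
    ∑ N (λ i → f (suc i)) + f (suc N)                      ∎
    where open ≡-Reasoning

  sum-cartesianProductWith : ∀ {A B C : Set} (g : A → B → C) (F : C → ℕ) xs ys →
    sum (map F (cartesianProductWith g xs ys)) ≡ sum (map (λ x → sum (map (F ∘ g x) ys)) xs)
  sum-cartesianProductWith g F []       ys = refl
  sum-cartesianProductWith g F (x ∷ xs) ys = begin
    sum (map F (map (g x) ys ++ cartesianProductWith g xs ys))
      ≡⟨ cong sum (map-++ F (map (g x) ys) _) ⟩
    sum (map F (map (g x) ys) ++ map F (cartesianProductWith g xs ys))
      ≡⟨ sum-++ (map F (map (g x) ys)) _ ⟩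
    sum (map F (map (g x) ys)) + sum (map F (cartesianProductWith g xs ys))
      ≡⟨ cong₂ _+_ (cong sum (sym (map-∘ ys))) (sum-cartesianProductWith g F xs ys) ⟩
    sum (map (F ∘ g x) ys) + sum (map (λ x → sum (map (F ∘ g x) ys)) xs) ∎
    where open ≡-Reasoning

  sum-tuples : ∀ k N (F : Vec ℕ k → ℕ) → sum (map F (tuples k N)) ≡ ∑ᵛ k N F
  sum-tuples zero    N F = +-identityʳ _
  sum-tuples (suc k) N F = begin
    sum (map F (cartesianProductWith _∷_ [1⋯ N ] (tuples k N)))
      ≡⟨ sum-cartesianProductWith _∷_ F [1⋯ N ] (tuples k N) ⟩
    sum (map (λ n → sum (map (F ∘ (n ∷_)) (tuples k N))) [1⋯ N ])
      ≡⟨ sum-[1⋯] N _ ⟩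
    ∑ N (λ i → sum (map (F ∘ (suc i ∷_)) (tuples k N)))
      ≡⟨ ∑-cong N (λ i _ → sum-tuples k N (F ∘ (suc i ∷_))) ⟩
    ∑ N (λ i → ∑ᵛ k N (F ∘ (suc i ∷_))) ∎
    where open ≡-Reasoning

  Between1And : ∀ {k} → ℕ → Vec ℕ k → Set
  Between1And N = All (λ n → 1 ≤ n × n ≤ N)

  ∑ᵛ-cong : ∀ k N {F G} → (∀ ns → Between1And N ns → F ns ≡ G ns) → ∑ᵛ k N F ≡ ∑ᵛ k N G
  ∑ᵛ-cong zero    N h = h [] []
  ∑ᵛ-cong (suc k) N h = ∑-cong N (λ i i<N → ∑ᵛ-cong k N (λ ns hs → h (suc i ∷ ns) ((s≤s z≤n , i<N) ∷ hs)))

  ∑ᵛ-∑ : ∀ k N m (F : ℕ → Vec ℕ k → ℕ) → ∑ᵛ k N (λ ns → ∑ m (λ i → F i ns)) ≡ ∑ m (λ i → ∑ᵛ k N (F i))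
  ∑ᵛ-∑ zero    N m F = refl
  ∑ᵛ-∑ (suc k) N m F = trans
    (∑-cong N (λ i _ → ∑ᵛ-∑ k N m (λ j ns → F j (suc i ∷ ns))))
    (∑-swap N m _)

  ∑ᵛ-*ˡ : ∀ k N c (F : Vec ℕ k → ℕ) → ∑ᵛ k N (λ ns → c * F ns) ≡ c * ∑ᵛ k N F
  ∑ᵛ-*ˡ zero    N c F = refl
  ∑ᵛ-*ˡ (suc k) N c F = trans (∑-cong N (λ i _ → ∑ᵛ-*ˡ k N c (λ ns → F (suc i ∷ ns)))) (∑-*ˡ N c _)

  ∑ᵛ-1 : ∀ k N → ∑ᵛ k N (λ _ → 1) ≡ N ^ k
  ∑ᵛ-1 zero    N = refl
  ∑ᵛ-1 (suc k) N = trans (∑-cong N (λ _ _ → ∑ᵛ-1 k N)) (∑-const N (N ^ k))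

  allMultiples? : ∀ {k} q (ns : Vec ℕ k) → Dec (All (q ∣_) ns)
  allMultiples? q = all? (q ∣?_)

  𝟙-allMultiples-∷ : ∀ {k} q n (ns : Vec ℕ k) →
    𝟙 (allMultiples? q (n ∷ ns)) ≡ 𝟙 (q ∣? n) * 𝟙 (allMultiples? q ns)
  𝟙-allMultiples-∷ q n ns with q ∣? n | allMultiples? q ns
  ... | yes _ | yes _ = refl
  ... | yes _ | no _  = refl
  ... | no _  | yes _ = refl
  ... | no _  | no _  = refl

  -- Scaling by `q` maps the tuples with entries up to `N / q` bijectively onto those tuples with
  -- entries up to `N` whose entries are all multiples of `q`. Coordinate by coordinate this is
  -- `∑-/`.
  ∑ᵛ-/ : ∀ k q .{{_ : NonZero q}} N (F : Vec ℕ k → ℕ) →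
    ∑ᵛ k (N / q) (λ ns → F (Vec.map (q *_) ns)) ≡ ∑ᵛ k N (λ ns → 𝟙 (allMultiples? q ns) * F ns)
  ∑ᵛ-/ zero    q N F = sym (*-identityˡ _)
  ∑ᵛ-/ (suc k) q N F = begin
    ∑ (N / q) (λ j → ∑ᵛ k (N / q) (λ ns → F (q * suc j ∷ Vec.map (q *_) ns)))
      ≡⟨ ∑-cong (N / q) (λ j _ → ∑ᵛ-/ k q N (λ ns → F (q * suc j ∷ ns))) ⟩
    ∑ (N / q) (λ j → rest (q * suc j))
      ≡⟨ ∑-/ q N rest ⟩
    ∑ N (λ i → 𝟙 (q ∣? suc i) * rest (suc i))
      ≡⟨ ∑-cong N (λ i _ → sym (∑ᵛ-*ˡ k N (𝟙 (q ∣? suc i)) _)) ⟩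
    ∑ N (λ i → ∑ᵛ k N (λ ns → 𝟙 (q ∣? suc i) * (𝟙 (allMultiples? q ns) * F (suc i ∷ ns))))
      ≡⟨ ∑-cong N (λ i _ → ∑ᵛ-cong k N (λ ns _ →
           trans (sym (*-assoc (𝟙 (q ∣? suc i)) _ _))
             (cong (_* F (suc i ∷ ns)) (sym (𝟙-allMultiples-∷ q (suc i) ns))))) ⟩
    ∑ N (λ i → ∑ᵛ k N (λ ns → 𝟙 (allMultiples? q (suc i ∷ ns)) * F (suc i ∷ ns))) ∎
    where
    open ≡-Reasoning
    rest : ℕ → ℕ
    rest n = ∑ᵛ k N (λ ns → 𝟙 (allMultiples? q ns) * F (n ∷ ns))

  -- Divisibility by powers and the generalized gcd.

  ^-distrib-* : ∀ m n b → (m * n) ^ b ≡ m ^ b * n ^ b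
  ^-distrib-* m n zero    = refl
  ^-distrib-* m n (suc b) = trans (cong (m * n *_) (^-distrib-* m n b))
    (solve 4 (λ m n x y → (m :* n) :* (x :* y) := (m :* x) :* (n :* y)) refl m n (m ^ b) (n ^ b))

  ^-monoˡ-∣ : ∀ b {m n} → m ∣ n → m ^ b ∣ n ^ b
  ^-monoˡ-∣ b {m} (divides q refl) = divides (q ^ b) (^-distrib-* q m b)

  coprime-* : ∀ {m n o} → Coprime m o → Coprime n o → Coprime (m * n) o
  coprime-* {m} {n} {o} m⊥o n⊥o {d} (d∣mn , d∣o) = n⊥o (coprime-divisor d⊥m d∣mn , d∣o)
    where
    d⊥m : Coprime d m
    d⊥m (e∣d , e∣m) = m⊥o (e∣m , ∣-trans e∣d d∣o)

  coprime-^ : ∀ b {m n} → Coprime m n → Coprime (m ^ b) n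
  coprime-^ zero    {m} {n} c = Coprimality.1-coprimeTo n
  coprime-^ (suc b) {m} {n} c = coprime-* c (coprime-^ b c)

  coprime-*-∣ : ∀ {m n o} → Coprime m n → m ∣ o → n ∣ o → m * n ∣ o
  coprime-*-∣ {m} {n} m⊥n (divides q refl) n∣o =
    subst (_∣ q * m) (*-comm n m)
      (*-monoˡ-∣ m (coprime-divisor (Coprimality.sym m⊥n) (subst (n ∣_) (*-comm q m) n∣o)))

  -- Divide out the gcd g: if m = m′ g, n = n′ g and o = o′ gᵇ, then the coprime powers m′ᵇ and n′ᵇ
  -- both divide o′, hence so does their product, while lcm m n = m′ n′ g.
  ^-lcm : ∀ b m n o .{{_ : NonZero m}} → m ^ b ∣ o → n ^ b ∣ o → lcm m n ^ b ∣ o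
  ^-lcm b m n o m^b∣o n^b∣o = subst (λ l → l ^ b ∣ o) (sym l≡) result
    where
    g = gcd m n
    instance
      g≢0 : NonZero g
      g≢0 = ≢-nonZero (λ e → ≢-nonZero⁻¹ m (gcd[m,n]≡0⇒m≡0 e))
      g^b≢0 : NonZero (g ^ b)
      g^b≢0 = m^n≢0 g b
    m′ = quotient (gcd[m,n]∣m m n)
    n′ = quotient (gcd[m,n]∣n m n)
    m≡ : m ≡ m′ * g
    m≡ = m∣n⇒n≡quotient*m (gcd[m,n]∣m m n)
    n≡ : n ≡ n′ * g
    n≡ = m∣n⇒n≡quotient*m (gcd[m,n]∣n m n)
    m′⊥n′ : Coprime m′ n′
    m′⊥n′ = subst₂ Coprime (n/m≡quotient (gcd[m,n]∣m m n)) (n/m≡quotient (gcd[m,n]∣n m n))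
              (GCD≡1⇒coprime (GCD-/gcd m n))
    l≡ : lcm m n ≡ m′ * n′ * g
    l≡ = *-cancelˡ-≡ (lcm m n) (m′ * n′ * g) g
      (trans (gcd*lcm m n) (trans (cong₂ _*_ m≡ n≡)
        (solve 3 (λ x y g → (x :* g) :* (y :* g) := g :* (x :* y :* g)) refl m′ n′ g)))
    g^b∣o : g ^ b ∣ o
    g^b∣o = ∣-trans (^-monoˡ-∣ b (gcd[m,n]∣m m n)) m^b∣o
    o′ = quotient g^b∣o
    o≡ : o ≡ o′ * g ^ b
    o≡ = m∣n⇒n≡quotient*m g^b∣o
    cancel : ∀ {x y} → x ≡ y * g → x ^ b ∣ o → y ^ b ∣ o′
    cancel {x} {y} x≡ x^b∣o = *-cancelʳ-∣ (g ^ b)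
      (subst₂ _∣_ (trans (cong (_^ b) x≡) (^-distrib-* y g b)) o≡ x^b∣o)
    result : (m′ * n′ * g) ^ b ∣ o
    result = subst₂ _∣_ (trans (cong (_* g ^ b) (sym (^-distrib-* m′ n′ b))) (sym (^-distrib-* (m′ * n′) g b)))
      (sym o≡)
      (*-monoˡ-∣ (g ^ b) (coprime-*-∣
        (coprime-^ b (Coprimality.sym (coprime-^ b (Coprimality.sym m′⊥n′))))
        (cancel m≡ m^b∣o) (cancel n≡ n^b∣o)))

  module _ {k} .{{_ : NonZero k}} b .{{_ : NonZero b}} where

    isMax : (ns : Vec ℕ k) → All (1 ≤_) ns →
      (1 ≤ powerGcd b ns × CommonPowerDivisor b (powerGcd b ns) ns) ×
      (∀ d → 1 ≤ d → CommonPowerDivisor b d ns → d ≤ powerGcd b ns)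
    isMax ns@(_ ∷ _) = powerGcd-isMax b ns (>-nonZero⁻¹ b)

    powerGcd-≤ : ∀ N (ns : Vec ℕ k) → Between1And N ns → powerGcd b ns ≤ N
    powerGcd-≤ N ns@(_ ∷ _) ns∈@((n≥1 , n≤N) ∷ _) with proj₂ (proj₁ (isMax ns (All.map proj₁ ns∈)))
    ... | g^b∣n ∷ _ = ≤-trans (subst (_≤ g ^ b) (^-identityʳ g) (^-monoʳ-≤ g {{g≢0}} (>-nonZero⁻¹ b)))
            (≤-trans (∣⇒≤ {{>-nonZero n≥1}} g^b∣n) n≤N)
      where
      g = powerGcd b ns
      g≢0 = >-nonZero (proj₁ (proj₁ (isMax ns (All.map proj₁ ns∈))))

  module _ {k} .{{_ : NonZero k}} b .{{_ : NonZero b}} (ns : Vec ℕ k) (ns≥1 : All (1 ≤_) ns) where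

    private
      g = powerGcd b ns
      g-isMax = isMax b ns ns≥1
      instance
        g≢0 : NonZero g
        g≢0 = >-nonZero (proj₁ (proj₁ g-isMax))

    powerGcd≢0 : NonZero g
    powerGcd≢0 = g≢0

    ∣powerGcd⇒^∣ : ∀ d → d ∣ g → CommonPowerDivisor b d ns
    ∣powerGcd⇒^∣ d d∣g = All.map (∣-trans (^-monoˡ-∣ b d∣g)) (proj₂ (proj₁ g-isMax))

    -- Maximality is upgraded to divisibility: by `^-lcm` the number `lcm d g` is again a common
    -- power divisor, so it is at most `g`; being a multiple of `g`, it equals `g`.
    ^∣⇒∣powerGcd : ∀ d .{{_ : NonZero d}} → CommonPowerDivisor b d ns → d ∣ g
    ^∣⇒∣powerGcd d d^b∣ns = subst (d ∣_) l≡g (m∣lcm[m,n] d g)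
      where
      l = lcm d g
      l≥1 : 1 ≤ l
      l≥1 = n≢0⇒n>0 (λ e → ≢-nonZero⁻¹ (d * g) {{m*n≢0 d g}}
        (trans (sym (gcd*lcm d g)) (trans (cong (gcd d g *_) e) (*-zeroʳ (gcd d g)))))
      l≤g : l ≤ g
      l≤g = proj₂ g-isMax l l≥1
        (All.map (λ {n} (p , q) → ^-lcm b d g n p q) (All.zip (d^b∣ns , proj₂ (proj₁ g-isMax))))
      l≡g : l ≡ g
      l≡g = ≤-antisym l≤g (∣⇒≤ {{>-nonZero l≥1}} (n∣lcm[m,n] d g))

  map-*-positive : ∀ {k} q .{{_ : NonZero q}} (ns : Vec ℕ k) → All (1 ≤_) ns → All (1 ≤_) (Vec.map (q *_) ns)
  map-*-positive q []       []       = []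
  map-*-positive q (n ∷ ns) (h ∷ hs) = *-mono-≤ (>-nonZero⁻¹ q) h ∷ map-*-positive q ns hs

  map-*-∣⁺ : ∀ {k} q {d} (ns : Vec ℕ k) → All (d ∣_) ns → All (q * d ∣_) (Vec.map (q *_) ns)
  map-*-∣⁺ q []       []       = []
  map-*-∣⁺ q (n ∷ ns) (h ∷ hs) = *-monoʳ-∣ q h ∷ map-*-∣⁺ q ns hs

  map-*-∣⁻ : ∀ {k} q .{{_ : NonZero q}} {d} (ns : Vec ℕ k) → All (q * d ∣_) (Vec.map (q *_) ns) → All (d ∣_) ns
  map-*-∣⁻ q []       []       = []
  map-*-∣⁻ q (n ∷ ns) (h ∷ hs) = *-cancelˡ-∣ q h ∷ map-*-∣⁻ q ns hs

  -- One direction scales the divisor `g` up. For the other, `m` is now known to divide `G`, so the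
  -- factor mᵇ can be cancelled from the power of `G` that divides the scaled entries.
  powerGcd-* : ∀ {k} .{{_ : NonZero k}} b .{{_ : NonZero b}} m .{{_ : NonZero m}} (ns : Vec ℕ k) → All (1 ≤_) ns →
    powerGcd b (Vec.map (m ^ b *_) ns) ≡ m * powerGcd b ns
  powerGcd-* b m ns ns≥1 = ∣-antisym G∣mg mg∣G
    where
    instance
      m^b≢0 : NonZero (m ^ b)
      m^b≢0 = m^n≢0 m b
      g≢0 : NonZero (powerGcd b ns)
      g≢0 = powerGcd≢0 b ns ns≥1
    g = powerGcd b ns
    ms = Vec.map (m ^ b *_) ns
    ms≥1 : All (1 ≤_) ms
    ms≥1 = map-*-positive (m ^ b) ns ns≥1
    G = powerGcd b ms
    mg∣G : m * g ∣ G
    mg∣G = ^∣⇒∣powerGcd b ms ms≥1 (m * g) {{m*n≢0 m g}}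
      (subst (λ d → All (d ∣_) ms) (sym (^-distrib-* m g b))
        (map-*-∣⁺ (m ^ b) ns (∣powerGcd⇒^∣ b ns ns≥1 g ∣-refl)))
    m∣G : m ∣ G
    m∣G = ∣-trans (m∣m*n g) mg∣G
    t = quotient m∣G
    G≡ : G ≡ m * t
    G≡ = m∣n⇒n≡m*quotient m∣G
    t∣g : t ∣ g
    t∣g = ^∣⇒∣powerGcd b ns ns≥1 t {{quotient≢0 m∣G {{powerGcd≢0 b ms ms≥1}}}}
      (map-*-∣⁻ (m ^ b) ns (subst (λ d → All (d ∣_) ms) (trans (cong (_^ b) G≡) (^-distrib-* m t b))
        (∣powerGcd⇒^∣ b ms ms≥1 G ∣-refl)))
    G∣mg : G ∣ m * g
    G∣mg = subst (_∣ m * g) (sym G≡) (*-monoʳ-∣ m t∣g)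


  -- The counting identity, with m = 1 + i throughout.

  ⌊_/[1+_]^_⌋ : ℕ → ℕ → ℕ → ℕ
  ⌊ N /[1+ i ]^ b ⌋ = _/_ N (suc i ^ b) {{m^n≢0 (suc i) b}}

  -- Both sides equal the sum over all vectors ns of the divisor sum of powerGcd b ns: on the
  -- left, powerGcd at ns / (1 + i)ᵇ is the divisor complementary to 1 + i.
  ∑-M : ∀ k .{{_ : NonZero k}} b .{{_ : NonZero b}} N →
    ∑ N (λ i → M id b k ⌊ N /[1+ i ]^ b ⌋) ≡ ∑ N (λ i → suc i * ⌊ N /[1+ i ]^ b ⌋ ^ k)
  ∑-M k b N = begin
    ∑ N (λ i → M id b k ⌊ N /[1+ i ]^ b ⌋)
      ≡⟨ ∑-cong N (λ i _ → left i) ⟩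
    ∑ N (λ i → ∑ᵛ k N (λ ns → ∑ N (λ j → pair i j ns * suc j)))
      ≡⟨ ∑ᵛ-∑ k N N _ ⟨
    ∑ᵛ k N (λ ns → ∑ N (λ i → ∑ N (λ j → pair i j ns * suc j)))
      ≡⟨ ∑ᵛ-cong k N (λ ns ns∈ → trans (∑-swap N N _) (∑-cong N (λ j _ → middle j ns ns∈))) ⟩
    ∑ᵛ k N (λ ns → ∑ N (λ j → suc j * 𝟙 (allMultiples? (suc j ^ b) ns)))
      ≡⟨ ∑ᵛ-∑ k N N _ ⟩
    ∑ N (λ j → ∑ᵛ k N (λ ns → suc j * 𝟙 (allMultiples? (suc j ^ b) ns)))
      ≡⟨ ∑-cong N (λ j _ → right j) ⟩
    ∑ N (λ j → suc j * ⌊ N /[1+ j ]^ b ⌋ ^ k) ∎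
    where
    open ≡-Reasoning
    pair : ℕ → ℕ → Vec ℕ k → ℕ
    pair i j ns = 𝟙 (suc i * suc j ≟ powerGcd b ns)
    positive : ∀ {n N} {ns : Vec ℕ n} → Between1And N ns → All (1 ≤_) ns
    positive = All.map proj₁
    left : ∀ i → M id b k ⌊ N /[1+ i ]^ b ⌋ ≡ ∑ᵛ k N (λ ns → ∑ N (λ j → pair i j ns * suc j))
    left i = begin
      M id b k (N / q)
        ≡⟨ sum-tuples k (N / q) _ ⟩
      ∑ᵛ k (N / q) (powerGcd b)
        ≡⟨ ∑ᵛ-cong k (N / q) (λ ns ns∈ → sym (complement ns ns∈)) ⟩
      ∑ᵛ k (N / q) (λ ns → ∑ N (λ j → pair i j (Vec.map (q *_) ns) * suc j))
        ≡⟨ ∑ᵛ-/ k q N (λ ns → ∑ N (λ j → pair i j ns * suc j)) ⟩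
      ∑ᵛ k N (λ ns → 𝟙 (allMultiples? q ns) * ∑ N (λ j → pair i j ns * suc j))
        ≡⟨ ∑ᵛ-cong k N absorb ⟩
      ∑ᵛ k N (λ ns → ∑ N (λ j → pair i j ns * suc j)) ∎
      where
      q = suc i ^ b
      instance
        q≢0 : NonZero q
        q≢0 = m^n≢0 (suc i) b
      complement : ∀ ns → Between1And (N / q) ns →
        ∑ N (λ j → pair i j (Vec.map (q *_) ns) * suc j) ≡ powerGcd b ns
      complement ns ns∈ = trans
        (∑-pick N (λ j → suc i * suc j ≡ G) (λ j → suc i * suc j ≟ G) suc (pred g) g≤N
          (trans (cong (suc i *_) suc-g) (sym G≡))
          (λ j e → suc-injective (trans (*-cancelˡ-≡ (suc j) g (suc i) (trans e G≡)) (sym suc-g))))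
        suc-g
        where
        g = powerGcd b ns
        G = powerGcd b (Vec.map (q *_) ns)
        G≡ : G ≡ suc i * g
        G≡ = powerGcd-* b (suc i) ns (positive ns∈)
        suc-g : suc (pred g) ≡ g
        suc-g = suc-pred g {{powerGcd≢0 b ns (positive ns∈)}}
        g≤N : pred g < N
        g≤N = subst (_≤ N) (sym suc-g) (≤-trans (powerGcd-≤ b (N / q) ns ns∈) (m/n≤m N q))
      -- A nonzero `pair i j ns` makes 1 + i a divisor of the power gcd, so the restriction to
      -- multiples of `q` holds automatically.
      absorb : ∀ ns → Between1And N ns →
        𝟙 (allMultiples? q ns) * ∑ N (λ j → pair i j ns * suc j) ≡ ∑ N (λ j → pair i j ns * suc j)
      absorb ns ns∈ = trans (sym (∑-*ˡ N (𝟙 (allMultiples? q ns)) _)) (∑-cong N (λ j _ →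
        trans (sym (*-assoc (𝟙 (allMultiples? q ns)) _ _)) (cong (_* suc j)
          (𝟙-absorb (allMultiples? q ns) (suc i * suc j ≟ powerGcd b ns)
            (λ e → ∣powerGcd⇒^∣ b ns (positive ns∈) (suc i) (subst (suc i ∣_) e (m∣m*n (suc j))))))))
    -- For fixed `j` at most one `i` completes 1 + j to the power gcd, and one does exactly when 1 +
    -- j divides it, that is, when (1 + j)ᵇ divides every entry.
    middle : ∀ j ns → Between1And N ns →
      ∑ N (λ i → pair i j ns * suc j) ≡ suc j * 𝟙 (allMultiples? (suc j ^ b) ns)
    middle j ns ns∈ = trans
      (trans (∑-cong N (λ i _ → *-comm (pair i j ns) (suc j))) (∑-*ˡ N (suc j) _))
      (cong (suc j *_) count)
      where
      g = powerGcd b ns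
      count : ∑ N (λ i → pair i j ns) ≡ 𝟙 (allMultiples? (suc j ^ b) ns)
      count with suc j ∣? g
      ... | no ∤g = trans
            (trans (∑-cong N (λ i _ → 𝟙-false (suc i * suc j ≟ g) (λ e → ∤g (divides (suc i) (sym e))))) (∑-zero N))
            (sym (𝟙-false (allMultiples? (suc j ^ b) ns) (λ h → ∤g (^∣⇒∣powerGcd b ns (positive ns∈) (suc j) h))))
      ... | yes ∣g@(divides zero e) = contradiction e (≢-nonZero⁻¹ g {{powerGcd≢0 b ns (positive ns∈)}})
      ... | yes ∣g@(divides (suc i) e) = trans
            (trans (∑-cong N (λ i _ → sym (*-identityʳ (pair i j ns))))
              (∑-pick N (λ i → suc i * suc j ≡ g) (λ i → suc i * suc j ≟ g) (λ _ → 1) i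
                (≤-trans (≤-trans (m≤m*n (suc i) (suc j)) (≤-reflexive (sym e)))
                  (powerGcd-≤ b N ns ns∈))
                (sym e)
                (λ i′ e′ → suc-injective (*-cancelʳ-≡ (suc i′) (suc i) (suc j) (trans e′ e)))))
            (sym (𝟙-true (allMultiples? (suc j ^ b) ns) (∣powerGcd⇒^∣ b ns (positive ns∈) (suc j) ∣g)))
    right : ∀ j → ∑ᵛ k N (λ ns → suc j * 𝟙 (allMultiples? (suc j ^ b) ns)) ≡ suc j * ⌊ N /[1+ j ]^ b ⌋ ^ k
    right j = trans (∑ᵛ-*ˡ k N (suc j) _) (cong (suc j *_) (begin
      ∑ᵛ k N (λ ns → 𝟙 (allMultiples? q ns))
        ≡⟨ ∑ᵛ-cong k N (λ ns _ → sym (*-identityʳ _)) ⟩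
      ∑ᵛ k N (λ ns → 𝟙 (allMultiples? q ns) * 1)
        ≡⟨ ∑ᵛ-/ k q N (λ _ → 1) ⟨
      ∑ᵛ k (N / q) (λ _ → 1)
        ≡⟨ ∑ᵛ-1 k (N / q) ⟩
      (N / q) ^ k ∎))
      where
      q = suc j ^ b
      instance
        q≢0 : NonZero q
        q≢0 = m^n≢0 (suc j) b

-- Rational estimates: powers, ∑ 1 / m² and the effect of the floors.

module Estimate where

  open import Algebra.Bundles using (CommutativeRing)
  import Data.Integer as ℤ
  import Data.Integer.Properties as ℤ
  open import Data.Nat as ℕ using (ℕ; zero; suc; NonZero; z≤n; s≤s)
  open import Data.Nat.DivMod using (m/n*n≤m; m<n⇒m/n≡0; m≡m%n+[m/n]*n; m%n<n)
  import Data.Nat.Properties as ℕ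
  open import Data.Rational using (ℚ; 0ℚ; 1ℚ; _+_; _*_; _-_; ∣_∣; _≤_; _/_)
  import Data.Rational as ℚ
  import Data.Rational.Properties as ℚ
  import Data.Rational.Unnormalised as ℚᵘ
  import Data.Rational.Unnormalised.Properties as ℚᵘ
  open import Data.Rational.Solver using (module +-*-Solver)
  open import Data.Sum using (inj₁; inj₂)
  open import Function using (id; _∘_)
  open import Relation.Binary.PropositionalEquality
  open import Relation.Nullary.Decidable using (from-yes)
  open +-*-Solver using (solve; _:=_; _:+_; _:*_; _:-_; con)
  open Defs using (M)
  open Defs.Rational
  open Counting using (⌊_/[1+_]^_⌋; ∑-M)
  open import Algebra.Properties.CommutativeSemiring.Exp
    (CommutativeRing.commutativeSemiring ℚ.+-*-commutativeRing) public
    using (_^_; ^-homo-*; ^-assocʳ; ^-distrib-*)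

  ι-* : ∀ m n → ι (m ℕ.* n) ≡ ι m * ι n
  ι-* zero    n = sym (ℚ.*-zeroˡ (ι n))
  ι-* (suc m) n = trans (ι-+ n (m ℕ.* n)) (trans (cong (ι n +_) (ι-* m n))
    (trans (lem (ι m) (ι n)) (cong (_* ι n) (sym (ι-suc m)))))
    where
    lem : ∀ a b → b + a * b ≡ (a + 1ℚ) * b
    lem = solve 2 (λ a b → b :+ a :* b := (a :+ con 1ℚ) :* b) refl

  ι-^ : ∀ m n → ι (m ℕ.^ n) ≡ ι m ^ n
  ι-^ m zero    = refl
  ι-^ m (suc n) = trans (ι-* m (m ℕ.^ n)) (cong (ι m *_) (ι-^ m n))

  ι-mono : ∀ {m n} → m ℕ.≤ n → ι m ≤ ι n
  ι-mono {m} {n} m≤n = subst (ι m ≤_) (trans (sym (ι-+ m (n ℕ.∸ m))) (cong ι (ℕ.m+[n∸m]≡n m≤n)))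
    (p≤p+q (ι-nonNeg (n ℕ.∸ m)))

  ι-inverse : ∀ m .{{_ : NonZero m}} → ι m * (ℤ.+ 1 / m) ≡ 1ℚ
  ι-inverse m@(suc p) = ℚ.toℚᵘ-injective
    (ℚᵘ.≃-trans (ℚ.toℚᵘ-homo-* (ι m) (ℤ.+ 1 / m))
    (ℚᵘ.≃-trans (ℚᵘ.*-cong (ℚ.toℚᵘ-fromℚᵘ (ℚᵘ.mkℚᵘ (ℤ.+ m) 0)) (ℚ.toℚᵘ-fromℚᵘ (ℚᵘ.mkℚᵘ (ℤ.+ 1) p)))
      (ℚᵘ.*≡* (cong ℤ.+_ (trans (ℕ.*-identityʳ (m ℕ.* 1)) (trans (ℕ.*-identityʳ m)
        (sym (trans (ℕ.*-identityˡ _) (ℕ.*-identityˡ m)))))))))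

  w : ℕ → ℚ
  w i = ℤ.+ 1 / suc i

  w≥0 : ∀ i → 0ℚ ≤ w i
  w≥0 i = inv-nonNeg (suc i)

  w≤1 : ∀ i → w i ≤ 1ℚ
  w≤1 i = inv-≤ (suc i) 1 (s≤s z≤n)

  ι-w : ∀ i → ι (suc i) * w i ≡ 1ℚ
  ι-w i = ι-inverse (suc i)

  1≤ι-suc : ∀ i → 1ℚ ≤ ι (suc i)
  1≤ι-suc i = ι-mono {1} {suc i} (s≤s z≤n)

  *-≤1 : ∀ {p q} → 0ℚ ≤ p → q ≤ 1ℚ → p * q ≤ p
  *-≤1 {p} {q} p≥0 q≤1 = subst (p * q ≤_) (ℚ.*-identityʳ p) (*-monoʳ p≥0 q≤1)

  ^-nonNeg : ∀ {p} n → 0ℚ ≤ p → 0ℚ ≤ p ^ n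
  ^-nonNeg zero    p≥0 = ℚ.<⇒≤ 0<1
  ^-nonNeg (suc n) p≥0 = *-nonNeg p≥0 (^-nonNeg n p≥0)

  ^-mono : ∀ {p q} n → 0ℚ ≤ p → p ≤ q → p ^ n ≤ q ^ n
  ^-mono zero    p≥0 p≤q = ℚ.≤-refl
  ^-mono (suc n) p≥0 p≤q = *-mono p≥0 (^-nonNeg n (ℚ.≤-trans p≥0 p≤q)) p≤q (^-mono n p≥0 p≤q)

  ^-≤1 : ∀ {p} n → 0ℚ ≤ p → p ≤ 1ℚ → p ^ n ≤ 1ℚ
  ^-≤1 zero    p≥0 p≤1 = ℚ.≤-refl
  ^-≤1 (suc n) p≥0 p≤1 = ℚ.≤-trans (*-≤1 p≥0 (^-≤1 n p≥0 p≤1)) p≤1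

  1^ : ∀ n → 1ℚ ^ n ≡ 1ℚ
  1^ zero    = refl
  1^ (suc n) = trans (ℚ.*-identityˡ _) (1^ n)

  -- The mean value bound for powers. It is one-sided, with no order assumed between `q` and `y`, so
  -- that it can be applied with the two exchanged to bound an absolute difference.
  ^-lipschitz : ∀ j {q y B d} → 0ℚ ≤ q → q ≤ B → 0ℚ ≤ y → y ≤ B → 0ℚ ≤ d → y ≤ q + d →
    y ^ suc j ≤ q ^ suc j + ι (suc j) * d * B ^ j
  ^-lipschitz zero {q} {y} {B} {d} q≥0 q≤B y≥0 y≤B d≥0 y≤q+d =
    subst₂ _≤_ (sym (ℚ.*-identityʳ y)) (lem q d) y≤q+d
    where
    lem : ∀ q d → q + d ≡ q * 1ℚ + 1ℚ * d * 1ℚ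
    lem = solve 2 (λ q d → q :+ d := q :* con 1ℚ :+ con 1ℚ :* d :* con 1ℚ) refl
  ^-lipschitz (suc j) {q} {y} {B} {d} q≥0 q≤B y≥0 y≤B d≥0 y≤q+d = begin
    y * y ^ suc j                                       ≤⟨ *-monoʳ y≥0 (^-lipschitz j q≥0 q≤B y≥0 y≤B d≥0 y≤q+d) ⟩
    y * (q ^ suc j + K * d * B ^ j)                     ≡⟨ lem₁ y (q ^ suc j) K d (B ^ j) ⟩
    y * q ^ suc j + K * d * (y * B ^ j)                 ≤⟨ ℚ.+-mono-≤ (*-monoˡ (^-nonNeg (suc j) q≥0) y≤q+d)
                                                            (*-monoʳ (*-nonNeg (ι-nonNeg (suc j)) d≥0) (*-monoˡ (^-nonNeg j B≥0) y≤B)) ⟩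
    (q + d) * q ^ suc j + K * d * B ^ suc j             ≡⟨ lem₂ q d (q ^ suc j) K (B ^ suc j) ⟩
    q ^ suc (suc j) + (d * q ^ suc j + K * d * B ^ suc j)  ≤⟨ ℚ.+-monoʳ-≤ (q ^ suc (suc j))
                                                            (ℚ.+-monoˡ-≤ (K * d * B ^ suc j) (*-monoʳ d≥0 (^-mono (suc j) q≥0 q≤B))) ⟩
    q ^ suc (suc j) + (d * B ^ suc j + K * d * B ^ suc j)  ≡⟨ cong (q ^ suc (suc j) +_)
                                                            (trans (lem₃ d (B ^ suc j) K) (cong (λ k → k * d * B ^ suc j) (sym (ι-suc (suc j))))) ⟩
    q ^ suc (suc j) + ι (suc (suc j)) * d * B ^ suc j   ∎
    where
    open ℚ.≤-Reasoning
    K = ι (suc j)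
    B≥0 = ℚ.≤-trans q≥0 q≤B
    lem₁ : ∀ y Q K d b → y * (Q + K * d * b) ≡ y * Q + K * d * (y * b)
    lem₁ = solve 5 (λ y Q K d b → y :* (Q :+ K :* d :* b) := y :* Q :+ K :* d :* (y :* b)) refl
    lem₂ : ∀ q d Q K b → (q + d) * Q + K * d * b ≡ q * Q + (d * Q + K * d * b)
    lem₂ = solve 5 (λ q d Q K b → (q :+ d) :* Q :+ K :* d :* b := q :* Q :+ (d :* Q :+ K :* d :* b)) refl
    lem₃ : ∀ d b K → d * b + K * d * b ≡ (K + 1ℚ) * d * b
    lem₃ = solve 3 (λ d b K → d :* b :+ K :* d :* b := (K :+ con 1ℚ) :* d :* b) refl

  zetaTerm-^ : ∀ s i → zetaTerm s i ≡ w i ^ s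
  zetaTerm-^ s i = begin
    z                                ≡⟨ ℚ.*-identityʳ z ⟨
    z * 1ℚ                           ≡⟨ cong (z *_) (trans (sym (1^ s)) (cong (_^ s) (sym (ι-w i)))) ⟩
    z * (ι (suc i) * w i) ^ s        ≡⟨ cong (z *_) (^-distrib-* (ι (suc i)) (w i) s) ⟩
    z * (ι (suc i) ^ s * w i ^ s)    ≡⟨ lem z (ι (suc i) ^ s) (w i ^ s) ⟩
    (ι (suc i) ^ s * z) * w i ^ s    ≡⟨ cong (λ t → t * z * w i ^ s) (ι-^ (suc i) s) ⟨
    (ι (suc i ℕ.^ s) * z) * w i ^ s  ≡⟨ cong (_* w i ^ s) (ι-inverse (suc i ℕ.^ s) {{ℕ.m^n≢0 (suc i) s}}) ⟩
    1ℚ * w i ^ s                     ≡⟨ ℚ.*-identityˡ _ ⟩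
    w i ^ s ∎
    where
    open ≡-Reasoning
    z = zetaTerm s i
    lem : ∀ a b c → a * (b * c) ≡ (b * a) * c
    lem = solve 3 (λ a b c → a :* (b :* c) := (b :* a) :* c) refl

  ∑-cong : ∀ n {f g : ℕ → ℚ} → (∀ i → f i ≡ g i) → ∑ n f ≡ ∑ n g
  ∑-cong zero    h = refl
  ∑-cong (suc n) h = cong₂ _+_ (∑-cong n h) (h n)

  ∑-mono : ∀ n {f g : ℕ → ℚ} → (∀ i → i ℕ.< n → f i ≤ g i) → ∑ n f ≤ ∑ n g
  ∑-mono zero    h = ℚ.≤-refl
  ∑-mono (suc n) h = ℚ.+-mono-≤ (∑-mono n (λ i i<n → h i (ℕ.m<n⇒m<1+n i<n))) (h n ℕ.≤-refl)

  ∑-- : ∀ n (f g : ℕ → ℚ) → ∑ n (λ i → f i - g i) ≡ ∑ n f - ∑ n g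
  ∑-- zero    f g = refl
  ∑-- (suc n) f g = trans (cong (_+ (f n - g n)) (∑-- n f g)) (lem (∑ n f) (∑ n g) (f n) (g n))
    where
    lem : ∀ a b c d → (a - b) + (c - d) ≡ (a + c) - (b + d)
    lem = solve 4 (λ a b c d → (a :- b) :+ (c :- d) := (a :+ c) :- (b :+ d)) refl

  ∑-*ˡ : ∀ n c (f : ℕ → ℚ) → ∑ n (λ i → c * f i) ≡ c * ∑ n f
  ∑-*ˡ zero    c f = sym (ℚ.*-zeroʳ c)
  ∑-*ˡ (suc n) c f = trans (cong (_+ c * f n) (∑-*ˡ n c f)) (sym (ℚ.*-distribˡ-+ c (∑ n f) (f n)))

  ∑-head : ∀ n (f : ℕ → ℚ) → ∑ (suc n) f ≡ f 0 + ∑ n (f ∘ suc)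
  ∑-head zero    f = ℚ.+-comm 0ℚ (f 0)
  ∑-head (suc n) f = trans (cong (_+ f (suc n)) (∑-head n f)) (ℚ.+-assoc (f 0) _ _)

  ∣∑∣≤ : ∀ n {f g : ℕ → ℚ} → (∀ i → i ℕ.< n → ∣ f i ∣ ≤ g i) → ∣ ∑ n f ∣ ≤ ∑ n g
  ∣∑∣≤ zero    h = ℚ.≤-refl
  ∣∑∣≤ (suc n) {f} h = ℚ.≤-trans (ℚ.∣p+q∣≤∣p∣+∣q∣ (∑ n f) (f n))
    (ℚ.+-mono-≤ (∣∑∣≤ n (λ i i<n → h i (ℕ.m<n⇒m<1+n i<n))) (h n ℕ.≤-refl))

  ∑-extend : ∀ {m n} (f : ℕ → ℚ) → m ℕ.≤ n → (∀ i → m ℕ.≤ i → f i ≡ 0ℚ) → ∑ n f ≡ ∑ m f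
  ∑-extend {n = zero}  f z≤n h = refl
  ∑-extend {m} {suc n} f m≤1+n h with ℕ.m≤n⇒m<n∨m≡n m≤1+n
  ... | inj₂ refl = refl
  ... | inj₁ m<1+n = trans (cong₂ _+_ (∑-extend f (ℕ.s≤s⁻¹ m<1+n) h) (h n (ℕ.s≤s⁻¹ m<1+n))) (ℚ.+-identityʳ _)

  ι-∑ : ∀ n f → ι (Counting.∑ n f) ≡ ∑ n (ι ∘ f)
  ι-∑ zero    f = refl
  ι-∑ (suc n) f = trans (ι-+ (Counting.∑ n f) (f n)) (cong (_+ ι (f n)) (ι-∑ n f))

  ¾ 7/4 2ℚ 3ℚ 4ℚ : ℚ
  ¾ = ℤ.+ 3 / 4
  7/4 = ℤ.+ 7 / 4
  2ℚ = ι 2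
  3ℚ = ι 3
  4ℚ = ι 4

  -- Adding the term `w (suc n)` to the partial sum makes it decreasing from two terms on, by
  -- telescoping; its value there is 1 + 1/4 + 1/2.
  ∑w² : ∀ n → ∑ n (λ i → w i ^ 2) ≤ 7/4
  ∑w² zero          = from-yes (0ℚ ℚ.≤? 7/4)
  ∑w² (suc zero)    = from-yes (∑ 1 (λ i → w i ^ 2) ℚ.≤? 7/4)
  ∑w² (suc (suc n)) = ℚ.≤-trans (p≤p+q (w≥0 (suc n))) (strong n)
    where
    step : ∀ n → w (suc n) ^ 2 + w (suc n) ≤ w n
    step n = subst (w (suc n) ^ 2 + w (suc n) ≤_) (lem (w n) (w (suc n)))
      (ℚ.+-monoˡ-≤ (w (suc n)) (subst (_≤ w n - w (suc n)) (zetaTerm-^ 2 (suc n)) (zetaTerm-≤ 2 ℕ.≤-refl n)))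
      where
      lem : ∀ a b → a - b + b ≡ a
      lem = solve 2 (λ a b → a :- b :+ b := a) refl
    strong : ∀ n → ∑ (suc (suc n)) (λ i → w i ^ 2) + w (suc n) ≤ 7/4
    strong zero    = from-yes (∑ 2 (λ i → w i ^ 2) + w 1 ℚ.≤? 7/4)
    strong (suc n) = ℚ.≤-trans
      (subst (_≤ ∑ (suc (suc n)) (λ i → w i ^ 2) + w (suc n))
        (sym (ℚ.+-assoc (∑ (suc (suc n)) (λ i → w i ^ 2)) (w (suc (suc n)) ^ 2) (w (suc (suc n)))))
        (ℚ.+-monoʳ-≤ (∑ (suc (suc n)) (λ i → w i ^ 2)) (step (suc n))))
      (strong n)

  ∑w²-tail : ∀ n → ∑ n (λ i → w (suc i) ^ 2) ≤ ¾
  ∑w²-tail n = subst₂ _≤_ (lem (∑ n (λ i → w (suc i) ^ 2))) refl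
    (ℚ.+-monoˡ-≤ (ℚ.- 1ℚ) (subst (_≤ 7/4) (∑-head n (λ i → w i ^ 2)) (∑w² (suc n))))
    where
    lem : ∀ a → (1ℚ + a) - 1ℚ ≡ a
    lem = solve 1 (λ a → (con 1ℚ :+ a) :- con 1ℚ := a) refl

  w^-≤w² : ∀ i {s} → 2 ℕ.≤ s → w i ^ s ≤ w i ^ 2
  w^-≤w² i (s≤s (s≤s (z≤n {s}))) = subst (_≤ w i ^ 2) (sym (^-homo-* (w i) 2 s))
    (*-≤1 (^-nonNeg 2 (w≥0 i)) (^-≤1 s (w≥0 i) (w≤1 i)))

  ι*w^suc : ∀ i s → ι (suc i) * w i ^ suc s ≡ w i ^ s
  ι*w^suc i s = trans (sym (ℚ.*-assoc (ι (suc i)) (w i) (w i ^ s)))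
    (trans (cong (_* w i ^ s) (ι-w i)) (ℚ.*-identityˡ _))

  module _ (b N i : ℕ) where

    private
      q = ⌊ N /[1+ i ]^ b ⌋
      instance
        _ = ℕ.m^n≢0 (suc i) b

      cancel : ∀ a → ι (a ℕ.* suc i ℕ.^ b) * w i ^ b ≡ ι a
      cancel a = trans (cong (_* w i ^ b) (trans (ι-* a (suc i ℕ.^ b)) (cong (ι a *_) (ι-^ (suc i) b))))
        (trans (ℚ.*-assoc (ι a) _ _) (trans (cong (ι a *_)
          (trans (sym (^-distrib-* (ι (suc i)) (w i) b)) (trans (cong (_^ b) (ι-w i)) (1^ b))))
          (ℚ.*-identityʳ (ι a))))

    ⌊⌋-≤ : ι q ≤ ι N * w i ^ b
    ⌊⌋-≤ = subst (_≤ ι N * w i ^ b) (cancel q) (*-monoˡ (^-nonNeg b (w≥0 i)) (ι-mono {q ℕ.* suc i ℕ.^ b} {N} (m/n*n≤m N (suc i ℕ.^ b))))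

    ≤-⌊⌋+1 : ι N * w i ^ b ≤ ι q + 1ℚ
    ≤-⌊⌋+1 = subst (ι N * w i ^ b ≤_) (trans (cancel (suc q)) (ι-suc q))
      (*-monoˡ (^-nonNeg b (w≥0 i)) (ι-mono {N} {suc q ℕ.* suc i ℕ.^ b} (ℕ.<⇒≤
        (subst (ℕ._< suc q ℕ.* suc i ℕ.^ b) (sym (m≡m%n+[m/n]*n N (suc i ℕ.^ b)))
          (ℕ.+-monoˡ-< (q ℕ.* suc i ℕ.^ b) (m%n<n N (suc i ℕ.^ b)))))))

  module _ (b k : ℕ) where

    -- The gain in the k-th power when the floor of N / mᵇ is dropped.
    defect : ℕ → ℕ → ℚ
    defect N i = (ι N * w i ^ b) ^ k - ι ⌊ N /[1+ i ]^ b ⌋ ^ k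

    error : ℚ → ℕ → ℚ
    error c N = ι (M id b k N) - c * ι N ^ k

    defect≥0 : ∀ N i → 0ℚ ≤ defect N i
    defect≥0 N i = subst (_≤ defect N i) (ℚ.+-inverseʳ (ι ⌊ N /[1+ i ]^ b ⌋ ^ k))
      (ℚ.+-monoˡ-≤ (ℚ.- (ι ⌊ N /[1+ i ]^ b ⌋ ^ k)) (^-mono k (ι-nonNeg ⌊ N /[1+ i ]^ b ⌋) (⌊⌋-≤ b N i)))

    scaled-^ : ∀ N i → (ι N * w i ^ b) ^ k ≡ ι N ^ k * w i ^ (b ℕ.* k)
    scaled-^ N i = trans (^-distrib-* (ι N) (w i ^ b) k) (cong (ι N ^ k *_) (^-assocʳ (w i) b k))

  0^ : ∀ k .{{_ : NonZero k}} → 0ℚ ^ k ≡ 0ℚ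
  0^ (suc k) = ℚ.*-zeroˡ (0ℚ ^ k)

  -- The hypothesis on c makes the main terms cancel.
  ∑-error : ∀ b k .{{_ : NonZero b}} .{{_ : NonZero k}} c n →
    c * ∑ n (λ i → w i ^ (b ℕ.* k)) ≡ ∑ n (λ i → ι (suc i) * w i ^ (b ℕ.* k)) →
    ∀ N → N ℕ.≤ n →
    ∑ N (λ i → error b k c ⌊ N /[1+ i ]^ b ⌋) ≡ ∑ n (λ i → (c - ι (suc i)) * defect b k N i)
  ∑-error b k c n cZ₂≡Z₁ N N≤n = begin
    ∑ N (λ i → ι (M id b k (q i)) - c * ι (q i) ^ k)
      ≡⟨ ∑-- N _ _ ⟩
    ∑ N (λ i → ι (M id b k (q i))) - ∑ N (λ i → c * ι (q i) ^ k)
      ≡⟨ cong (_- ∑ N (λ i → c * ι (q i) ^ k)) (begin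
           ∑ N (λ i → ι (M id b k (q i)))          ≡⟨ ι-∑ N _ ⟨
           ι (Counting.∑ N (λ i → M id b k (q i))) ≡⟨ cong ι (∑-M k b N) ⟩
           ι (Counting.∑ N (λ i → suc i ℕ.* q i ℕ.^ k)) ≡⟨ ι-∑ N _ ⟩
           ∑ N (λ i → ι (suc i ℕ.* q i ℕ.^ k))     ≡⟨ ∑-cong N (λ i → trans (ι-* (suc i) (q i ℕ.^ k)) (cong (ι (suc i) *_) (ι-^ (q i) k))) ⟩
           ∑ N (λ i → ι (suc i) * ι (q i) ^ k)     ∎) ⟩
    ∑ N (λ i → ι (suc i) * ι (q i) ^ k) - ∑ N (λ i → c * ι (q i) ^ k)
      ≡⟨ ∑-- N _ _ ⟨
    ∑ N (λ i → ι (suc i) * ι (q i) ^ k - c * ι (q i) ^ k)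
      -- The sum has to reach the length `n` of the zeta sums. For i ≥ N one has (1 + i)ᵇ > N, so
      -- the quotients and with them the added terms are 0.
      ≡⟨ ∑-extend _ N≤n vanish ⟨
    ∑ n (λ i → ι (suc i) * ι (q i) ^ k - c * ι (q i) ^ k)
      ≡⟨ ℚ.+-identityʳ _ ⟨
    ∑ n (λ i → ι (suc i) * ι (q i) ^ k - c * ι (q i) ^ k) - 0ℚ
      ≡⟨ cong (∑ n (λ i → ι (suc i) * ι (q i) ^ k - c * ι (q i) ^ k) -_) (sym main) ⟩
    ∑ n (λ i → ι (suc i) * ι (q i) ^ k - c * ι (q i) ^ k) - ∑ n (λ i → ι (suc i) * y i ^ k - c * y i ^ k)
      ≡⟨ ∑-- n _ _ ⟨
    ∑ n (λ i → (ι (suc i) * ι (q i) ^ k - c * ι (q i) ^ k) - (ι (suc i) * y i ^ k - c * y i ^ k))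
      ≡⟨ ∑-cong n (λ i → lem (ι (suc i)) c (ι (q i) ^ k) (y i ^ k)) ⟩
    ∑ n (λ i → (c - ι (suc i)) * defect b k N i) ∎
    where
    open ≡-Reasoning
    q : ℕ → ℕ
    q i = ⌊ N /[1+ i ]^ b ⌋
    y : ℕ → ℚ
    y i = ι N * w i ^ b
    lem : ∀ p c Q Y → (p * Q - c * Q) - (p * Y - c * Y) ≡ (c - p) * (Y - Q)
    lem = solve 4 (λ p c Q Y → (p :* Q :- c :* Q) :- (p :* Y :- c :* Y) := (c :- p) :* (Y :- Q)) refl
    vanish : ∀ i → N ℕ.≤ i → ι (suc i) * ι (q i) ^ k - c * ι (q i) ^ k ≡ 0ℚ
    vanish i N≤i = trans
      (cong (λ t → ι (suc i) * t - c * t) (trans (cong (λ t → ι t ^ k) q≡0) (0^ k)))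
      (solve 2 (λ a c → a :* con 0ℚ :- c :* con 0ℚ := con 0ℚ) refl (ι (suc i)) c)
      where
      q≡0 : q i ≡ 0
      q≡0 = m<n⇒m/n≡0 {{ℕ.m^n≢0 (suc i) b}} (ℕ.≤-trans (s≤s N≤i)
        (subst (ℕ._≤ suc i ℕ.^ b) (ℕ.^-identityʳ (suc i)) (ℕ.^-monoʳ-≤ (suc i) (ℕ.>-nonZero⁻¹ b))))
    lem₂ : ∀ p c X W → p * (X * W) - c * (X * W) ≡ X * (p * W - c * W)
    lem₂ = solve 4 (λ p c X W → p :* (X :* W) :- c :* (X :* W) := X :* (p :* W :- c :* W)) refl
    main : ∑ n (λ i → ι (suc i) * y i ^ k - c * y i ^ k) ≡ 0ℚ
    main = begin
      ∑ n (λ i → ι (suc i) * y i ^ k - c * y i ^ k)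
        ≡⟨ ∑-cong n (λ i → trans (cong (λ t → ι (suc i) * t - c * t) (scaled-^ b k N i))
             (lem₂ (ι (suc i)) c (ι N ^ k) (w i ^ (b ℕ.* k)))) ⟩
      ∑ n (λ i → ι N ^ k * (ι (suc i) * w i ^ (b ℕ.* k) - c * w i ^ (b ℕ.* k)))
        ≡⟨ ∑-*ˡ n (ι N ^ k) _ ⟩
      ι N ^ k * ∑ n (λ i → ι (suc i) * w i ^ (b ℕ.* k) - c * w i ^ (b ℕ.* k))
        ≡⟨ cong (ι N ^ k *_) (trans (∑-- n _ _) (cong₂ _-_ (sym cZ₂≡Z₁) (∑-*ˡ n c _))) ⟩
      ι N ^ k * (c * Z₂ - c * Z₂)
        ≡⟨ cong (ι N ^ k *_) (ℚ.+-inverseʳ (c * Z₂)) ⟩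
      ι N ^ k * 0ℚ
        ≡⟨ ℚ.*-zeroʳ (ι N ^ k) ⟩
      0ℚ ∎
      where Z₂ = ∑ n (λ i → w i ^ (b ℕ.* k))

  -- The defects are nonnegative, so only the factors c - m need absolute values; 0 ≤ c ≤ 2 and m ≥
  -- 1 give c ≤ 4m and m ≤ c + 3m, whence the 3.
  ∣∑-error∣ : ∀ b k .{{_ : NonZero b}} .{{_ : NonZero k}} c n → 0ℚ ≤ c → c ≤ 2ℚ →
    c * ∑ n (λ i → w i ^ (b ℕ.* k)) ≡ ∑ n (λ i → ι (suc i) * w i ^ (b ℕ.* k)) →
    ∀ N → N ℕ.≤ n →
    ∣ ∑ N (λ i → error b k c ⌊ N /[1+ i ]^ b ⌋) ∣ ≤ 3ℚ * ∑ n (λ i → ι (suc i) * defect b k N i)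
  ∣∑-error∣ b k c n c≥0 c≤2 cZ₂≡Z₁ N N≤n = subst₂ _≤_
    (cong ∣_∣ (sym (∑-error b k c n cZ₂≡Z₁ N N≤n)))
    (∑-*ˡ n 3ℚ _)
    (∣∑∣≤ n (λ i _ → subst₂ _≤_
      (sym (trans (ℚ.∣p*q∣≡∣p∣*∣q∣ (c - ι (suc i)) (defect b k N i))
        (cong (∣ c - ι (suc i) ∣ *_) (ℚ.0≤p⇒∣p∣≡p (defect≥0 b k N i)))))
      (ℚ.*-assoc 3ℚ (ι (suc i)) (defect b k N i))
      (*-monoˡ (defect≥0 b k N i) (∣-∣≤ (≤₁ (ι (suc i)) (1≤ι-suc i)) (≤₂ (ι (suc i)) (1≤ι-suc i))))))
    where
    ≤₁ : ∀ p → 1ℚ ≤ p → c ≤ p + 3ℚ * p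
    ≤₁ p 1≤p = ℚ.≤-trans c≤2 (ℚ.≤-trans (*-monoʳ {r = 2ℚ} (ι-nonNeg 2) 1≤p)
      (subst (2ℚ * p ≤_) (lem p) (p≤p+q (*-nonNeg (ι-nonNeg 2) (ℚ.≤-trans (ℚ.<⇒≤ 0<1) 1≤p)))))
      where
      lem : ∀ p → 2ℚ * p + 2ℚ * p ≡ p + 3ℚ * p
      lem = solve 1 (λ p → con 2ℚ :* p :+ con 2ℚ :* p := p :+ con 3ℚ :* p) refl
    ≤₂ : ∀ p → 1ℚ ≤ p → p ≤ c + 3ℚ * p
    ≤₂ p 1≤p = ℚ.≤-trans (subst (p ≤_) (lem p) (p≤p+q (*-nonNeg (ι-nonNeg 2) (ℚ.≤-trans (ℚ.<⇒≤ 0<1) 1≤p)))) (p≤q+p c≥0)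
      where
      lem : ∀ p → p + 2ℚ * p ≡ 3ℚ * p
      lem = solve 1 (λ p → p :+ con 2ℚ :* p := con 3ℚ :* p) refl

-- The strong induction and the resulting error bounds.

module Recursion where

  open import Data.Nat as ℕ using (ℕ; zero; suc; z≤n; s≤s)
  open import Data.Nat.DivMod as ℕ using (m/n≤m; n/1≡n; m/n<m)
  import Data.Nat.Properties as ℕ
  open import Data.Nat.Induction using (<-rec)
  open import Data.Rational using (ℚ; 0ℚ; 1ℚ; _+_; _*_; _-_; ∣_∣; _≤_)
  import Data.Rational as ℚ
  import Data.Rational.Properties as ℚ
  open import Data.Rational.Solver using (module +-*-Solver)
  open import Data.Sum using (inj₁; inj₂)
  open import Function using (_∘_)
  open import Relation.Binary.PropositionalEquality
  open import Relation.Nullary.Decidable using (from-yes)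
  open +-*-Solver using (solve; _:=_; _:+_; _:*_; _:-_; con)
  open Defs.Rational
  open Counting using (⌊_/[1+_]^_⌋)
  open Estimate

  -- Since ∑_{m ≥ 2} 1 / m² ≤ 3/4 < 1, a bound A for the sum over m of the values of E
  -- at N / mᵇ gives the bound A + (3/4)(4A) = 4A for the term m = 1, that is for E N.
  module _ (E L : ℕ → ℚ) (b j n : ℕ) (A : ℚ) (2≤b : 2 ℕ.≤ b) (A≥0 : 0ℚ ≤ A)
           (L≥0 : ∀ N → 0ℚ ≤ L N) (L-mono : ∀ {m n} → m ℕ.≤ n → L m ≤ L n)
           (E0≡0 : E 0 ≡ 0ℚ)
           (∑E-≤ : ∀ N → N ℕ.≤ n → ∣ ∑ N (λ i → E ⌊ N /[1+ i ]^ b ⌋) ∣ ≤ A * (ι N ^ suc j * L N)) where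

    private
      size : ℕ → ℚ
      size N = ι N ^ suc j * L N

      size≥0 : ∀ N → 0ℚ ≤ size N
      size≥0 N = *-nonNeg (^-nonNeg (suc j) (ι-nonNeg N)) (L≥0 N)

      4A≥0 : 0ℚ ≤ 4ℚ * A
      4A≥0 = *-nonNeg (ι-nonNeg 4) A≥0

      2≤bj : 2 ℕ.≤ b ℕ.* suc j
      2≤bj = ℕ.≤-trans 2≤b (ℕ.m≤m*n b (suc j))

      -- Passing from N to ⌊N / mᵇ⌋ divides the power by at least m^(b(j+1)), and b(j+1) ≥ 2. The
      -- factor `L` is merely monotone and is kept at `L N`.
      size-⌊⌋ : ∀ N i → size ⌊ N /[1+ i ]^ b ⌋ ≤ size N * w i ^ 2
      size-⌊⌋ N i = ℚ.≤-trans
        (*-mono (^-nonNeg (suc j) (ι-nonNeg q)) (L≥0 N)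
          (^-mono (suc j) (ι-nonNeg q) (⌊⌋-≤ b N i)) (L-mono (m/n≤m N (suc i ℕ.^ b) {{ℕ.m^n≢0 (suc i) b}})))
        (subst₂ _≤_ (sym (trans (cong (_* L N) (scaled-^ b (suc j) N i)) (lem (ι N ^ suc j) (w i ^ (b ℕ.* suc j)) (L N)))) refl
          (*-monoʳ (size≥0 N) (w^-≤w² i 2≤bj)))
        where
        q = ⌊ N /[1+ i ]^ b ⌋
        lem : ∀ a b c → a * b * c ≡ a * c * b
        lem = solve 3 (λ a b c → a :* b :* c := a :* c :* b) refl

      ⌊⌋-< : ∀ N i → ⌊ suc N /[1+ suc i ]^ b ⌋ ℕ.< suc N
      ⌊⌋-< N i = m/n<m (suc N) (suc (suc i) ℕ.^ b) {{_}} {{ℕ.m^n≢0 (suc (suc i)) b}} (ℕ.≤-trans (s≤s (s≤s z≤n))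
        (subst (ℕ._≤ suc (suc i) ℕ.^ b) (ℕ.^-identityʳ (suc (suc i)))
          (ℕ.^-monoʳ-≤ (suc (suc i)) (ℕ.≤-trans (s≤s z≤n) 2≤b))))

      ⌊⌋-0 : ∀ N → ⌊ N /[1+ 0 ]^ b ⌋ ≡ N
      ⌊⌋-0 N = trans (ℕ./-congʳ {{ℕ.m^n≢0 1 b}} (ℕ.^-zeroˡ b)) (n/1≡n N)

    recursive-bound : ∀ N → N ℕ.≤ n → ∣ E N ∣ ≤ 4ℚ * A * (ι N ^ suc j * L N)
    recursive-bound = <-rec (λ N → N ℕ.≤ n → ∣ E N ∣ ≤ 4ℚ * A * size N) step
      where
      step : ∀ N → (∀ {m} → m ℕ.< N → m ℕ.≤ n → ∣ E m ∣ ≤ 4ℚ * A * size m) → N ℕ.≤ n → ∣ E N ∣ ≤ 4ℚ * A * size N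
      step zero    ih N≤n = subst (_≤ 4ℚ * A * size 0) (sym (cong ∣_∣ E0≡0)) (*-nonNeg 4A≥0 (size≥0 0))
      step (suc N) ih N≤n = begin
        ∣ E N′ ∣                                    ≡⟨ cong ∣_∣ (lem₁ (E N′) rest) ⟨
        ∣ (E N′ + rest) - rest ∣                    ≤⟨ ℚ.∣p-q∣≤∣p∣+∣q∣ (E N′ + rest) rest ⟩
        ∣ E N′ + rest ∣ + ∣ rest ∣                  ≤⟨ ℚ.+-mono-≤ whole tail ⟩
        A * size N′ + 4ℚ * A * (size N′ * ¾)        ≡⟨ lem₂ A (size N′) ⟩
        4ℚ * A * size N′ ∎
        where
        open ℚ.≤-Reasoning
        N′ = suc N
        f : ℕ → ℚ
        f i = E ⌊ N′ /[1+ i ]^ b ⌋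
        rest = ∑ N (f ∘ suc)
        lem₁ : ∀ a r → (a + r) - r ≡ a
        lem₁ = solve 2 (λ a r → (a :+ r) :- r := a) refl
        lem₂ : ∀ a s → a * s + 4ℚ * a * (s * ¾) ≡ 4ℚ * a * s
        lem₂ = solve 2 (λ a s → a :* s :+ con 4ℚ :* a :* (s :* con ¾) := con 4ℚ :* a :* s) refl
        whole : ∣ E N′ + rest ∣ ≤ A * size N′
        whole = subst (λ t → ∣ t ∣ ≤ A * size N′)
          (trans (∑-head N f) (cong (λ q → E q + rest) (⌊⌋-0 N′))) (∑E-≤ N′ N≤n)
        tail : ∣ rest ∣ ≤ 4ℚ * A * (size N′ * ¾)
        tail = ℚ.≤-trans
          (∣∑∣≤ N {g = λ i → 4ℚ * A * (size N′ * w (suc i) ^ 2)} (λ i _ → ℚ.≤-trans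
            (ih (⌊⌋-< N i) (ℕ.≤-trans (ℕ.<⇒≤ (⌊⌋-< N i)) N≤n))
            (*-monoʳ 4A≥0 (size-⌊⌋ N′ (suc i)))))
          (subst (_≤ 4ℚ * A * (size N′ * ¾))
            (sym (trans (∑-*ˡ N (4ℚ * A) _) (cong (4ℚ * A *_) (∑-*ˡ N (size N′) _))))
            (*-monoʳ 4A≥0 (*-monoʳ (size≥0 N′) (∑w²-tail N))))

  module _ (s : ℕ) (2≤s : 2 ℕ.≤ s) where

    -- By computation this is the n-th term of the real quotient ζ(s) / ζ(s + 1), so rational
    -- estimates carry over to it without rewriting.
    ζ-ratio : ℕ → ℚ
    ζ-ratio n = ∑ (suc n) (zetaTerm s) * recip 1ℚ 0<1 (∑ (suc n) (zetaTerm (suc s)))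

    ζ-ratio≥0 : ∀ n → 0ℚ ≤ ζ-ratio n
    ζ-ratio≥0 n = *-nonNeg (∑-≥0 (suc n) (zetaTerm-nonNeg s)) (recip-nonNeg 1ℚ 0<1 (∑ (suc n) (zetaTerm (suc s))))

    ζ-ratio≤2 : ∀ n → ζ-ratio n ≤ 2ℚ
    ζ-ratio≤2 n = ℚ.≤-trans
      (*-≤1 (∑-≥0 (suc n) (zetaTerm-nonNeg s)) (recip-≤ 1ℚ 0<1 (∑ (suc n) (zetaTerm (suc s)))))
      (ℚ.≤-trans
        (∑-mono (suc n) (λ i _ → subst (_≤ w i ^ 2) (sym (zetaTerm-^ s i)) (w^-≤w² i 2≤s)))
        (ℚ.≤-trans (∑w² (suc n)) (from-yes (7/4 ℚ.≤? 2ℚ))))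

    -- By `zeta-≥1` the maximum inside `recip` is the partial sum itself, so `recip` is a true
    -- inverse here. This supplies the hypothesis on `c` in `∑-error`.
    ζ-ratio-* : ∀ n → ζ-ratio n * ∑ (suc n) (λ i → w i ^ suc s) ≡ ∑ (suc n) (λ i → ι (suc i) * w i ^ suc s)
    ζ-ratio-* n = begin
      Z₁ * r * ∑ (suc n) (λ i → w i ^ suc s)    ≡⟨ cong (Z₁ * r *_) (∑-cong (suc n) (λ i → sym (zetaTerm-^ (suc s) i))) ⟩
      Z₁ * r * Z₂                               ≡⟨ lem Z₁ r Z₂ ⟩
      Z₁ * (Z₂ * r)                             ≡⟨ cong (λ t → Z₁ * (t * r)) (ℚ.p≤q⇒p⊔q≡q (zeta-≥1 (suc s) n)) ⟨
      Z₁ * ((1ℚ ℚ.⊔ Z₂) * r)                    ≡⟨ cong (Z₁ *_) (⊔-recip 1ℚ 0<1 Z₂) ⟩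
      Z₁ * 1ℚ                                   ≡⟨ ℚ.*-identityʳ Z₁ ⟩
      Z₁                                        ≡⟨ ∑-cong (suc n) (λ i → trans (zetaTerm-^ s i) (sym (ι*w^suc i s))) ⟩
      ∑ (suc n) (λ i → ι (suc i) * w i ^ suc s) ∎
      where
      open ≡-Reasoning
      Z₁ = ∑ (suc n) (zetaTerm s)
      Z₂ = ∑ (suc n) (zetaTerm (suc s))
      r = recip 1ℚ 0<1 Z₂
      lem : ∀ a b c → a * b * c ≡ a * (c * b)
      lem = solve 3 (λ a b c → a :* b :* c := a :* (c :* b)) refl

  error-0 : ∀ b k c → error b (suc k) c 0 ≡ 0ℚ
  error-0 b k c = trans (cong (λ t → 0ℚ - c * t) (0^ (suc k)))
    (solve 1 (λ c → con 0ℚ :- c :* con 0ℚ := con 0ℚ) refl c)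

  -- The floor moves the base y = N / mᵇ by at most 1 and both bases are at most y, so `^-lipschitz`
  -- applies with d = 1 and B = y.
  defect-≤ : ∀ b j N i → defect b (suc j) N i ≤ ι (suc j) * (ι N ^ j * w i ^ (b ℕ.* j))
  defect-≤ b j N i = ≤⇒-≤ (subst (λ t → y ^ suc j ≤ q ^ suc j + t)
      (trans (cong (_* y ^ j) (ℚ.*-identityʳ (ι (suc j)))) (cong (ι (suc j) *_) (scaled-^ b j N i)))
      (^-lipschitz j (ι-nonNeg ⌊ N /[1+ i ]^ b ⌋) (⌊⌋-≤ b N i) y≥0 ℚ.≤-refl (ℚ.<⇒≤ 0<1) (≤-⌊⌋+1 b N i)))
    where
    y = ι N * w i ^ b
    q = ι ⌊ N /[1+ i ]^ b ⌋
    y≥0 : 0ℚ ≤ y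
    y≥0 = *-nonNeg (ι-nonNeg N) (^-nonNeg b (w≥0 i))

  -- With k = j + 2 the weight m leaves the exponent b(k-1) - 1, which b ≥ 3 makes at least 2.
  ι*defect-≤ : ∀ b j N i → 3 ℕ.≤ b →
    ι (suc i) * defect b (suc (suc j)) N i ≤ ι (suc (suc j)) * ι N ^ suc j * w i ^ 2
  ι*defect-≤ b j N i 3≤b = begin
    p * defect b (suc (suc j)) N i                  ≤⟨ *-monoʳ (ι-nonNeg (suc i)) (defect-≤ b (suc j) N i) ⟩
    p * (K * (X * w i ^ (b ℕ.* suc j)))             ≡⟨ lem p K X (w i ^ (b ℕ.* suc j)) ⟩
    K * X * (p * w i ^ (b ℕ.* suc j))               ≡⟨ cong (λ e → K * X * (p * w i ^ e)) (sym (ℕ.suc-pred _ {{ℕ.>-nonZero (ℕ.≤-trans (s≤s z≤n) 3≤bj)}})) ⟩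
    K * X * (p * w i ^ suc (ℕ.pred (b ℕ.* suc j)))  ≡⟨ cong (K * X *_) (ι*w^suc i (ℕ.pred (b ℕ.* suc j))) ⟩
    K * X * w i ^ ℕ.pred (b ℕ.* suc j)              ≤⟨ *-monoʳ (*-nonNeg (ι-nonNeg (suc (suc j))) (^-nonNeg (suc j) (ι-nonNeg N)))
                                                        (w^-≤w² i (ℕ.pred-mono-≤ 3≤bj)) ⟩
    K * X * w i ^ 2 ∎
    where
    open ℚ.≤-Reasoning
    p = ι (suc i)
    K = ι (suc (suc j))
    X = ι N ^ suc j
    3≤bj : 3 ℕ.≤ b ℕ.* suc j
    3≤bj = ℕ.≤-trans 3≤b (ℕ.m≤m*n b (suc j))
    lem : ∀ p K X W → p * (K * (X * W)) ≡ K * X * (p * W)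
    lem = solve 4 (λ p K X W → p :* (K :* (X :* W)) := K :* X :* (p :* W)) refl

  module _ (b j s : ℕ) (3≤b : 3 ℕ.≤ b) (bk≡ : b ℕ.* suc (suc j) ≡ suc s) (2≤s : 2 ℕ.≤ s) where

    private
      K A : ℚ
      K = ι (suc (suc j))
      -- The 3 comes from `∣∑-error∣`, the factor k from `defect-≤`, and 2 is an upper bound for ∑ 1
      -- / m².
      A = 3ℚ * (K * 2ℚ)
      instance
        _ = ℕ.>-nonZero (ℕ.≤-trans (s≤s z≤n) 3≤b)

    error-≤ : ∀ n N → N ℕ.≤ n →
      ∣ error b (suc (suc j)) (ζ-ratio s 2≤s n) N ∣ ≤ 4ℚ * A * (ι N ^ suc j * 1ℚ)
    error-≤ n N N≤n = recursive-bound (error b (suc (suc j)) c) (λ _ → 1ℚ) b j (suc n) A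
      (ℕ.≤-trans (ℕ.n≤1+n 2) 3≤b) (*-nonNeg (ι-nonNeg 3) (*-nonNeg (ι-nonNeg (suc (suc j))) (ι-nonNeg 2)))
      (λ _ → ℚ.<⇒≤ 0<1) (λ _ → ℚ.≤-refl) (error-0 b (suc j) c)
      ∑error-≤ N (ℕ.≤-trans N≤n (ℕ.n≤1+n n))
      where
      c = ζ-ratio s 2≤s n
      lem : ∀ K X → 3ℚ * (K * X * 2ℚ) ≡ 3ℚ * (K * 2ℚ) * (X * 1ℚ)
      lem = solve 2 (λ K X → con 3ℚ :* (K :* X :* con 2ℚ) := con 3ℚ :* (K :* con 2ℚ) :* (X :* con 1ℚ)) refl
      ∑error-≤ : ∀ N → N ℕ.≤ suc n →
        ∣ ∑ N (λ i → error b (suc (suc j)) c ⌊ N /[1+ i ]^ b ⌋) ∣ ≤ A * (ι N ^ suc j * 1ℚ)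
      ∑error-≤ N N≤ = ℚ.≤-trans
        (∣∑-error∣ b (suc (suc j)) c (suc n) (ζ-ratio≥0 s 2≤s n) (ζ-ratio≤2 s 2≤s n)
          (subst (λ e → c * ∑ (suc n) (λ i → w i ^ e) ≡ ∑ (suc n) (λ i → ι (suc i) * w i ^ e)) (sym bk≡) (ζ-ratio-* s 2≤s n))
          N N≤)
        (subst (3ℚ * ∑ (suc n) (λ i → ι (suc i) * defect b (suc (suc j)) N i) ≤_) (lem K (ι N ^ suc j))
          (*-monoʳ {r = 3ℚ} (ι-nonNeg 3) (ℚ.≤-trans
            (∑-mono (suc n) (λ i _ → ι*defect-≤ b j N i 3≤b))
            (subst (_≤ K * ι N ^ suc j * 2ℚ) (sym (∑-*ˡ (suc n) (K * ι N ^ suc j) _))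
              (*-monoʳ (*-nonNeg (ι-nonNeg (suc (suc j))) (^-nonNeg (suc j) (ι-nonNeg N)))
                (ℚ.≤-trans (∑w² (suc n)) (from-yes (7/4 ℚ.≤? 2ℚ))))))))

  -- The case b = k = 2 and the harmonic sum.

  harmonic : ℕ → ℚ
  harmonic N = ∑ N w

  harmonic-mono : ∀ {m n} → m ℕ.≤ n → harmonic m ≤ harmonic n
  harmonic-mono {n = zero}  z≤n = ℚ.≤-refl
  harmonic-mono {m} {suc n} m≤1+n with ℕ.m≤n⇒m<n∨m≡n m≤1+n
  ... | inj₂ refl = ℚ.≤-refl
  ... | inj₁ m<1+n = ℚ.≤-trans (harmonic-mono (ℕ.s≤s⁻¹ m<1+n)) (p≤p+q (w≥0 n))

  1+harmonic≥0 : ∀ N → 0ℚ ≤ 1ℚ + harmonic N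
  1+harmonic≥0 N = ℚ.≤-trans (ℚ.<⇒≤ 0<1) (p≤p+q (∑-≥0 N w≥0))

  -- The exponent b(k-1) - 1 is only 1 here; summed over m ≤ N this bound yields the harmonic sum.
  ι*defect₂₂-<N : ∀ N i → ι (suc i) * defect 2 2 N i ≤ ι N * (2ℚ * w i)
  ι*defect₂₂-<N N i = subst (ι (suc i) * defect 2 2 N i ≤_)
    (trans (lem (ι (suc i)) (ι N) (w i)) (cong (λ t → ι N * (2ℚ * t)) (trans (cong (_* w i) (ι-w i)) (ℚ.*-identityˡ (w i)))))
    (*-monoʳ (ι-nonNeg (suc i)) (defect-≤ 2 1 N i))
    where
    lem : ∀ p N w → p * (2ℚ * ((N * 1ℚ) * (w * (w * 1ℚ)))) ≡ N * (2ℚ * ((p * w) * w))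
    lem = solve 3 (λ p N w → p :* (con 2ℚ :* ((N :* con 1ℚ) :* (w :* (w :* con 1ℚ)))) := N :* (con 2ℚ :* ((p :* w) :* w))) refl

  ι*defect₂₂-≥N : ∀ N i → N ℕ.≤ i → ι (suc i) * defect 2 2 N i ≤ ι N * w i ^ 2
  ι*defect₂₂-≥N N i N≤i = begin
    p * (y ^ 2 - q ^ 2)                      ≤⟨ *-monoʳ (ι-nonNeg (suc i)) (≤⇒-≤ {y ^ 2} {q ^ 2} {y ^ 2} (p≤q+p (^-nonNeg 2 (ι-nonNeg ⌊ N /[1+ i ]^ 2 ⌋)))) ⟩
    p * y ^ 2                                ≡⟨ lem p (ι N) (w i) ⟩
    ι N * w i ^ 2 * (ι N * w i * (p * w i))  ≡⟨ cong (ι N * w i ^ 2 *_) (trans (cong (ι N * w i *_) (ι-w i)) (ℚ.*-identityʳ _)) ⟩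
    ι N * w i ^ 2 * (ι N * w i)              ≤⟨ *-≤1 (*-nonNeg (ι-nonNeg N) (^-nonNeg 2 (w≥0 i))) Nw≤1 ⟩
    ι N * w i ^ 2 ∎
    where
    open ℚ.≤-Reasoning
    p = ι (suc i)
    y = ι N * w i ^ 2
    q = ι ⌊ N /[1+ i ]^ 2 ⌋
    Nw≤1 : ι N * w i ≤ 1ℚ
    Nw≤1 = subst (ι N * w i ≤_) (ι-w i) (*-monoˡ (w≥0 i) (ι-mono {N} {suc i} (ℕ.≤-trans N≤i (ℕ.n≤1+n i))))
    lem : ∀ p N w → p * ((N * (w * (w * 1ℚ))) * ((N * (w * (w * 1ℚ))) * 1ℚ)) ≡ N * (w * (w * 1ℚ)) * (N * w * (p * w))
    lem = solve 3 (λ p N w → p :* ((N :* (w :* (w :* con 1ℚ))) :* ((N :* (w :* (w :* con 1ℚ))) :* con 1ℚ))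
                     := N :* (w :* (w :* con 1ℚ)) :* (N :* w :* (p :* w))) refl

  ∑-defect₂₂-≤ : ∀ N n → N ℕ.≤ n →
    ∑ n (λ i → ι (suc i) * defect 2 2 N i) ≤ ι N * (2ℚ * harmonic N + ∑ n (λ i → w i ^ 2))
  ∑-defect₂₂-≤ N zero    z≤n = ℚ.≤-refl
  ∑-defect₂₂-≤ N (suc n) N≤1+n with ℕ.m≤n⇒m<n∨m≡n N≤1+n
  ... | inj₁ N<1+n = subst (∑ (suc n) (λ i → ι (suc i) * defect 2 2 N i) ≤_)
        (lem (ι N) (2ℚ * harmonic N) (∑ n (λ i → w i ^ 2)) (w n ^ 2))
        (ℚ.+-mono-≤ (∑-defect₂₂-≤ N n (ℕ.s≤s⁻¹ N<1+n)) (ι*defect₂₂-≥N N n (ℕ.s≤s⁻¹ N<1+n)))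
    where
    lem : ∀ N h s t → N * (h + s) + N * t ≡ N * (h + (s + t))
    lem = solve 4 (λ N h s t → N :* (h :+ s) :+ N :* t := N :* (h :+ (s :+ t))) refl
  ... | inj₂ refl = ℚ.≤-trans
        (∑-mono N (λ i _ → ι*defect₂₂-<N N i))
        (subst (_≤ ι N * (2ℚ * harmonic N + ∑ N (λ i → w i ^ 2)))
          (sym (trans (∑-*ˡ N (ι N) _) (cong (ι N *_) (∑-*ˡ N 2ℚ w))))
          (*-monoʳ (ι-nonNeg N) (p≤p+q (∑-≥0 N (λ i → ^-nonNeg 2 (w≥0 i))))))

  error₂₂-≤ : ∀ n N → N ℕ.≤ n →
    ∣ error 2 2 (ζ-ratio 3 (s≤s (s≤s z≤n)) n) N ∣ ≤ 4ℚ * (3ℚ * 2ℚ) * (ι N ^ 1 * (1ℚ + harmonic N))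
  -- The slowly growing factor is L N = 1 + harmonic N, and A = 6 because 3N(2 harmonic N + 2) =
  -- 6N(1 + harmonic N), the summand 2 bounding ∑ 1 / m².
  error₂₂-≤ n N N≤n = recursive-bound (error 2 2 c) (λ N → 1ℚ + harmonic N) 2 0 (suc n) (3ℚ * 2ℚ)
    ℕ.≤-refl (*-nonNeg (ι-nonNeg 3) (ι-nonNeg 2)) 1+harmonic≥0
    (λ m≤n → ℚ.+-monoʳ-≤ 1ℚ (harmonic-mono m≤n)) (error-0 2 1 c)
    ∑error-≤ N (ℕ.≤-trans N≤n (ℕ.n≤1+n n))
    where
    2≤3 = s≤s (s≤s z≤n)
    c = ζ-ratio 3 2≤3 n
    lem : ∀ N h → 3ℚ * (N * (2ℚ * h + 2ℚ)) ≡ 3ℚ * 2ℚ * (N * 1ℚ * (1ℚ + h))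
    lem = solve 2 (λ N h → con 3ℚ :* (N :* (con 2ℚ :* h :+ con 2ℚ)) := con 3ℚ :* con 2ℚ :* (N :* con 1ℚ :* (con 1ℚ :+ h))) refl
    ∑error-≤ : ∀ N → N ℕ.≤ suc n → ∣ ∑ N (λ i → error 2 2 c ⌊ N /[1+ i ]^ 2 ⌋) ∣ ≤ 3ℚ * 2ℚ * (ι N ^ 1 * (1ℚ + harmonic N))
    ∑error-≤ N N≤ = ℚ.≤-trans
      (∣∑-error∣ 2 2 c (suc n) (ζ-ratio≥0 3 2≤3 n) (ζ-ratio≤2 3 2≤3 n) (ζ-ratio-* 3 2≤3 n) N N≤)
      (subst (3ℚ * ∑ (suc n) (λ i → ι (suc i) * defect 2 2 N i) ≤_) (lem (ι N) (harmonic N))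
        (*-monoʳ {r = 3ℚ} (ι-nonNeg 3) (ℚ.≤-trans (∑-defect₂₂-≤ N (suc n) N≤)
          (*-monoʳ (ι-nonNeg N) (ℚ.+-monoʳ-≤ (2ℚ * harmonic N)
            (ℚ.≤-trans (∑w² (suc n)) (from-yes (7/4 ℚ.≤? 2ℚ))))))))

-- A lower bound for the Riemann sums of the logarithm.

module Logarithm where

  open import Data.Nat as ℕ using (ℕ; zero; suc; s≤s)
  import Data.Nat.Properties as ℕ
  open import Data.Rational using (ℚ; 0ℚ; 1ℚ; _+_; _*_; _-_; _≤_)
  import Data.Rational as ℚ
  import Data.Rational.Properties as ℚ
  open import Data.Rational.Solver using (module +-*-Solver)
  open import Data.Sum using (inj₁; inj₂)
  open import Relation.Binary.PropositionalEquality
  open +-*-Solver using (solve; _:=_; _:+_; _:*_; _:-_; con)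
  open Defs.Rational
  open Estimate
  open Recursion

  r : ℚ → ℚ
  r = recip 1ℚ 0<1

  -- The segment over [J, J + 1] of the piecewise linear interpolation of J ↦ harmonic J - 1,
  -- extended to a line.  The interpolation is concave, and its slope is at most 1 / t at t.
  segment : ℕ → ℚ → ℚ
  segment J t = harmonic J - 1ℚ + (t - ι J) * w J

  -- The lines for J and J + 1 meet at J + 1, and the later one has the smaller slope.
  segment-suc : ∀ J {t} → ι (suc J) ≤ t → segment (suc J) t ≤ segment J t
  segment-suc J {t} J+1≤t = begin
    harmonic J + w J - 1ℚ + (t - ι (suc J)) * w (suc J)
      ≤⟨ ℚ.+-monoʳ-≤ (harmonic J + w J - 1ℚ) (*-monoʳ 0≤t-[J+1] (inv-≤ (suc (suc J)) (suc J) (ℕ.n≤1+n (suc J)))) ⟩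
    harmonic J + w J - 1ℚ + (t - ι (suc J)) * w J
      ≡⟨ cong (λ k → harmonic J + w J - 1ℚ + (t - k) * w J) (ι-suc J) ⟩
    harmonic J + w J - 1ℚ + (t - (ι J + 1ℚ)) * w J
      ≡⟨ lem (harmonic J) (w J) t (ι J) ⟩
    harmonic J - 1ℚ + (t - ι J) * w J ∎
    where
    open ℚ.≤-Reasoning
    0≤t-[J+1] : 0ℚ ≤ t - ι (suc J)
    0≤t-[J+1] = subst (_≤ t - ι (suc J)) (ℚ.+-inverseʳ (ι (suc J))) (ℚ.+-monoˡ-≤ (ℚ.- ι (suc J)) J+1≤t)
    lem : ∀ H w t J → H + w - 1ℚ + (t - (J + 1ℚ)) * w ≡ H - 1ℚ + (t - J) * w
    lem = solve 4 (λ H w t J → H :+ w :- con 1ℚ :+ (t :- (J :+ con 1ℚ)) :* w := H :- con 1ℚ :+ (t :- J) :* w) refl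

  segment-start : ∀ J {t} → ι J ≤ t → harmonic J - 1ℚ ≤ segment J t
  segment-start J {t} J≤t = p≤p+q (*-nonNeg
    (subst (_≤ t - ι J) (ℚ.+-inverseʳ (ι J)) (ℚ.+-monoˡ-≤ (ℚ.- ι J) J≤t)) (w≥0 J))

  segment-≥ : ∀ g J {t} → ι (g ℕ.+ J) ≤ t → harmonic (g ℕ.+ J) - 1ℚ ≤ segment J t
  segment-≥ zero    J h = segment-start J h
  segment-≥ (suc g) J {t} h = ℚ.≤-trans
    (subst (λ n → harmonic n - 1ℚ ≤ segment (suc J) t) (ℕ.+-suc g J)
      (segment-≥ g (suc J) (subst (λ n → ι n ≤ t) (sym (ℕ.+-suc g J)) h)))
    (segment-suc J (ℚ.≤-trans (ι-mono {suc J} {suc g ℕ.+ J} (s≤s (ℕ.m≤n+m J g))) h))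

  -- The part of the Riemann sum accumulated up to t exceeds the interpolation at min(N, t).
  data Dominates (N : ℕ) (S t : ℚ) : Set where
    past-end : harmonic N - 1ℚ ≤ S → Dominates N S t
    within   : ∀ g J → g ℕ.+ J ≡ N → ι J ≤ t → t ≤ ι (suc J) → segment J t ≤ S → Dominates N S t

  -- A long step may jump over several integers. Each one passed only lowers the line to be
  -- exceeded; `g` counts the integers left before N and makes the search end.
  climb : ∀ g J {N S t} → g ℕ.+ J ≡ N → ι J ≤ t → segment J t ≤ S → Dominates N S t
  climb zero    J refl J≤t ≤S = past-end (ℚ.≤-trans (segment-start J J≤t) ≤S)
  climb (suc g) J {t = t} e J≤t ≤S with ℚ.≤-total t (ι (suc J))
  ... | inj₁ t≤J+1 = within (suc g) J e J≤t t≤J+1 ≤S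
  ... | inj₂ J+1≤t = climb g (suc J) (trans (ℕ.+-suc g J) e) J+1≤t (ℚ.≤-trans (segment-suc J J+1≤t) ≤S)

  w≤r : ∀ J {t} → 1ℚ ≤ t → t ≤ ι (suc J) → w J ≤ r t
  w≤r J {t} 1≤t t≤J+1 = subst₂ _≤_ e₁ e₂ (*-monoˡ (*-nonNeg (w≥0 J) (recip-nonNeg 1ℚ 0<1 t)) t≤J+1)
    where
    lem : ∀ t w r → t * (w * r) ≡ w * (t * r)
    lem = solve 3 (λ t w r → t :* (w :* r) := w :* (t :* r)) refl
    e₁ : t * (w J * r t) ≡ w J
    e₁ = trans (lem t (w J) (r t)) (trans
      (cong (w J *_) (trans (cong (_* r t) (sym (ℚ.p≤q⇒p⊔q≡q 1≤t))) (⊔-recip 1ℚ 0<1 t)))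
      (ℚ.*-identityʳ (w J)))
    e₂ : ι (suc J) * (w J * r t) ≡ r t
    e₂ = trans (sym (ℚ.*-assoc (ι (suc J)) (w J) (r t))) (trans (cong (_* r t) (ι-w J)) (ℚ.*-identityˡ (r t)))

  -- A step from t adds h / t, at least h times the slope 1 / (J + 1) because t ≤ J + 1. Hence the
  -- sum stays above the extended line up to t + h, whatever the size of h.
  advance : ∀ {N S t h} → 1ℚ ≤ t → 0ℚ ≤ h → Dominates N S t → Dominates N (S + h * r t) (t + h)
  advance {t = t} 1≤t h≥0 (past-end ≤S) =
    past-end (ℚ.≤-trans ≤S (p≤p+q (*-nonNeg h≥0 (recip-nonNeg 1ℚ 0<1 t))))
  advance {S = S} {t} {h} 1≤t h≥0 (within g J e J≤t t≤J+1 ≤S) =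
    climb g J e (ℚ.≤-trans J≤t (p≤p+q h≥0))
      (subst (_≤ S + h * r t) (sym (lem (harmonic J) t h (ι J) (w J)))
        (ℚ.+-mono-≤ ≤S (*-monoʳ h≥0 (w≤r J 1≤t t≤J+1))))
    where
    lem : ∀ H t h J w → H - 1ℚ + (t + h - J) * w ≡ H - 1ℚ + (t - J) * w + h * w
    lem = solve 5 (λ H t h J w → H :- con 1ℚ :+ (t :+ h :- J) :* w := H :- con 1ℚ :+ (t :- J) :* w :+ h :* w) refl

  riemann-dominates : ∀ N K {h} → 0ℚ ≤ h → Dominates (suc N) (riemann K h) (1ℚ + ι K * h)
  riemann-dominates N zero {h} h≥0 = subst (Dominates (suc N) 0ℚ) (sym 1+0h≡1)
    (within N 1 (ℕ.+-comm N 1) ℚ.≤-refl (1≤ι-suc 1) ℚ.≤-refl)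
    where
    1+0h≡1 : 1ℚ + 0ℚ * h ≡ 1ℚ
    1+0h≡1 = solve 1 (λ h → con 1ℚ :+ con 0ℚ :* h := con 1ℚ) refl h
  riemann-dominates N (suc K) {h} h≥0 = subst (Dominates (suc N) (riemann (suc K) h)) next
    (advance (p≤p+q (*-nonNeg (ι-nonNeg K) h≥0)) h≥0 (riemann-dominates N K h≥0))
    where
    next : 1ℚ + ι K * h + h ≡ 1ℚ + ι (suc K) * h
    next = trans (lem (ι K) h) (cong (λ k → 1ℚ + k * h) (sym (ι-suc K)))
      where
      lem : ∀ k h → 1ℚ + k * h + h ≡ 1ℚ + (k + 1ℚ) * h
      lem = solve 2 (λ k h → con 1ℚ :+ k :* h :+ h := con 1ℚ :+ (k :+ con 1ℚ) :* h) refl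

  riemann-≥ : ∀ N K {h} → 0ℚ ≤ h → ι (suc N) ≤ 1ℚ + ι K * h → harmonic (suc N) - 1ℚ ≤ riemann K h
  riemann-≥ N K {h} h≥0 N≤ with riemann-dominates N K h≥0
  ... | past-end ≤S = ≤S
  ... | within g J e _ _ ≤S = ℚ.≤-trans
        (subst (λ n → harmonic n - 1ℚ ≤ segment J (1ℚ + ι K * h)) e
          (segment-≥ g J (subst (λ n → ι n ≤ 1ℚ + ι K * h) (sym e) N≤)))
        ≤S

  -- The n-th term of `log` has 2ⁿ steps, however coarse that is compared with N, which is why
  -- `riemann-≥` allows any number of steps. Here they have length u / 2ⁿ and end exactly at 1 + u.
  logSum-≥ : ∀ {N} → 1 ℕ.≤ N → ∀ n {u} → 0ℚ ≤ u → ι N ≤ 1ℚ + u → harmonic N - 1ℚ ≤ logSum n u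
  logSum-≥ {suc N} _ n {u} u≥0 N≤1+u = riemann-≥ N (2 ℕ.^ n) (*-nonNeg u≥0 (½^-nonNeg n))
    (subst (λ t → ι (suc N) ≤ 1ℚ + t) (sym e) N≤1+u)
    where
    lem : ∀ k u p → k * (u * p) ≡ u * (k * p)
    lem = solve 3 (λ k u p → k :* (u :* p) := u :* (k :* p)) refl
    e : ι (2 ℕ.^ n) * (u * ½^ n) ≡ u
    e = trans (lem (ι (2 ℕ.^ n)) u (½^ n)) (trans (cong (u *_) (2^*½^ n)) (ℚ.*-identityʳ u))

  -- The claim reduces to 2 + h ≤ 7(h - 1), that is h ≥ 3/2 = `harmonic 2`; so 7 is what N = 2
  -- requires. The index shift arises because ⌊x⌋ is `suc N` while the terms of x are only known to
  -- be at least N.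
  1+harmonic-≤ : ∀ N → 2 ℕ.≤ N → 1ℚ + harmonic (suc N) ≤ ι 7 * (harmonic N - 1ℚ)
  1+harmonic-≤ N 2≤N = begin
    1ℚ + (harmonic N + w N)         ≤⟨ ℚ.+-monoʳ-≤ 1ℚ (ℚ.+-monoʳ-≤ (harmonic N) (w≤1 N)) ⟩
    1ℚ + (harmonic N + 1ℚ)          ≡⟨ lem₁ (harmonic N) ⟩
    harmonic N + (ι 6 * harmonic 2 - ι 7)  ≤⟨ ℚ.+-monoʳ-≤ (harmonic N) (ℚ.+-monoˡ-≤ (ℚ.- ι 7) (*-monoʳ {r = ι 6} (ι-nonNeg 6) (harmonic-mono 2≤N))) ⟩
    harmonic N + (ι 6 * harmonic N - ι 7)  ≡⟨ lem₂ (harmonic N) ⟩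
    ι 7 * (harmonic N - 1ℚ) ∎
    where
    open ℚ.≤-Reasoning
    lem₁ : ∀ h → 1ℚ + (h + 1ℚ) ≡ h + (ι 6 * harmonic 2 - ι 7)
    lem₁ = solve 1 (λ h → con 1ℚ :+ (h :+ con 1ℚ) := h :+ con (ι 6 * harmonic 2 - ι 7)) refl
    lem₂ : ∀ h → h + (ι 6 * h - ι 7) ≡ ι 7 * (h - 1ℚ)
    lem₂ = solve 1 (λ h → h :+ (con (ι 6) :* h :- con (ι 7)) := con (ι 7) :* (h :- con 1ℚ)) refl

-- From the integer N to a real x with floor N.

module Transfer where

  open import Data.Nat as ℕ using (ℕ; zero; suc; z≤n; s≤s)
  import Data.Nat.Properties as ℕ
  open import Data.Product using (∃; _×_; _,_; proj₁; proj₂)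
  open import Data.Rational using (ℚ; 0ℚ; 1ℚ; ½; _+_; _*_; _-_; ∣_∣; _≤_)
  import Data.Rational as ℚ
  import Data.Rational.Properties as ℚ
  open import Data.Rational.Solver using (module +-*-Solver)
  open import Data.Sum using (inj₁; inj₂)
  open import Function using (Equivalence; id)
  open import Relation.Binary.PropositionalEquality
  open import Relation.Nullary using (contradiction)
  open +-*-Solver using (solve; _:=_; _:+_; _:*_; _:-_; con)
  open Defs using (M; ℝ; seq; cauchy; fromℕ; fromℚ; _IsFloorOf_; _∘floor≈_+O_)
  open Defs.Rational
  open Estimate
  open Recursion
  open Logarithm

  seq-^ : ∀ x k n → seq (x Defs.^ k) n ≡ seq x n ^ k
  seq-^ x zero    n = refl
  seq-^ x (suc k) n = cong (seq x n *_) (seq-^ x k n)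

  -- The terms of x may stay below ⌊x⌋ when x is an integer, so the lower bound gives up 1. The
  -- index is also taken at least `suc N`, so that the zeta sums are long enough.
  floor-bounds : ∀ {x N} → suc N IsFloorOf x →
    ∃ λ n₀ → ∀ n → n₀ ℕ.≤ n → suc N ℕ.≤ n × ι N ≤ seq x n × seq x n ≤ ι (suc N) + 2ℚ
  floor-bounds {x} {N} floor = suc N ℕ.⊔ (n₁ ℕ.⊔ n₂) , λ n n≥ →
    ℕ.m⊔n≤o⇒m≤o (suc N) (n₁ ℕ.⊔ n₂) n≥ ,
    lower n (ℕ.m⊔n≤o⇒m≤o n₁ n₂ (ℕ.m⊔n≤o⇒n≤o (suc N) _ n≥)) ,
    upper n (ℕ.m⊔n≤o⇒n≤o n₁ n₂ (ℕ.m⊔n≤o⇒n≤o (suc N) _ n≥))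
    where
    N≤x : fromℕ (suc N) Defs.≤ x
    N≤x = Equivalence.to (floor (suc N)) ℕ.≤-refl
    n₁ = proj₁ (N≤x 1ℚ 0<1)
    n₂ = proj₁ (cauchy x ½ 0<½)
    lower : ∀ n → n₁ ℕ.≤ n → ι N ≤ seq x n
    lower n n≥n₁ = subst₂ _≤_ (lem (ι N)) (lem (seq x n))
      (ℚ.+-monoˡ-≤ (ℚ.- 1ℚ) (subst (_≤ seq x n + 1ℚ) (ι-suc N) (proj₂ (N≤x 1ℚ 0<1) n n≥n₁)))
      where
      lem : ∀ a → a + 1ℚ - 1ℚ ≡ a
      lem = solve 1 (λ a → a :+ con 1ℚ :- con 1ℚ := a) refl
    close : ∀ m n → n₂ ℕ.≤ m → n₂ ℕ.≤ n → seq x m ≤ seq x n + ½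
    close m n m≥ n≥ = -≤⇒≤ (ℚ.≤-trans (p≤∣p∣ (seq x m - seq x n)) (proj₂ (cauchy x ½ 0<½) m n m≥ n≥))
    upper : ∀ n → n₂ ℕ.≤ n → seq x n ≤ ι (suc N) + 2ℚ
    -- Reals cannot be compared decidably, but this one rational term can. If it is at least ⌊x⌋ +
    -- 3/2, all later terms are at least ⌊x⌋ + 1, against the floor; otherwise they are at most ⌊x⌋
    -- + 2. The threshold leaves the Cauchy tolerance 1/2 on either side.
    upper n n≥ with ℚ.≤-total (seq x n₂) (ι (suc N) + (1ℚ + ½))
    ... | inj₁ small = ℚ.≤-trans (close n n₂ n≥ ℕ.≤-refl)
          (subst (seq x n₂ + ½ ≤_) (lem (ι (suc N))) (ℚ.+-monoˡ-≤ ½ small))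
      where
      lem : ∀ a → a + (1ℚ + ½) + ½ ≡ a + 2ℚ
      lem = solve 1 (λ a → a :+ con (1ℚ + ½) :+ con ½ := a :+ con 2ℚ) refl
    ... | inj₂ large = contradiction (Equivalence.from (floor (suc (suc N))) N+1≤x) ℕ.1+n≰n
      where
      N+1≤x : fromℕ (suc (suc N)) Defs.≤ x
      N+1≤x ε ε>0 = n₂ , λ m m≥ → ℚ.≤-trans
        (subst₂ _≤_ (trans (lem (ι (suc N))) (sym (ι-suc (suc N)))) (lem′ (seq x m))
          (ℚ.+-monoˡ-≤ (ℚ.- ½) (ℚ.≤-trans large (close n₂ m ℕ.≤-refl m≥))))
        (p≤p+q (ℚ.<⇒≤ ε>0))
        where
        lem : ∀ a → a + (1ℚ + ½) - ½ ≡ a + 1ℚ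
        lem = solve 1 (λ a → a :+ con (1ℚ + ½) :- con ½ := a :+ con 1ℚ) refl
        lem′ : ∀ a → a + ½ - ½ ≡ a
        lem′ = solve 1 (λ a → a :+ con ½ :- con ½ := a) refl

  module _ {t : ℚ} {N : ℕ} (1≤N : 1 ℕ.≤ N) (N≤t : ι N ≤ t) (t≤N+3 : t ≤ ι (suc N) + 2ℚ) where

    t≥0 : 0ℚ ≤ t
    t≥0 = ℚ.≤-trans (ι-nonNeg N) N≤t

    1+N≤4t : ι (suc N) ≤ 4ℚ * t
    1+N≤4t = ℚ.≤-trans
      (subst (_≤ ι N + 3ℚ * ι N) (sym (ι-suc N)) (ℚ.+-monoʳ-≤ (ι N)
        (ℚ.≤-trans (ι-mono {1} {N} 1≤N) (subst (ι N ≤_) (lem₁ (ι N)) (p≤p+q (*-nonNeg (ι-nonNeg 2) (ι-nonNeg N)))))))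
      (subst (_≤ 4ℚ * t) (lem₂ (ι N)) (*-monoʳ {r = 4ℚ} (ι-nonNeg 4) N≤t))
      where
      lem₁ : ∀ a → a + 2ℚ * a ≡ 3ℚ * a
      lem₁ = solve 1 (λ a → a :+ con 2ℚ :* a := con 3ℚ :* a) refl
      lem₂ : ∀ a → 4ℚ * a ≡ a + 3ℚ * a
      lem₂ = solve 1 (λ a → con 4ℚ :* a := a :+ con 3ℚ :* a) refl

    t≤4t : t ≤ 4ℚ * t
    t≤4t = subst (t ≤_) (lem t) (p≤p+q (*-nonNeg (ι-nonNeg 3) t≥0))
      where
      lem : ∀ a → a + 3ℚ * a ≡ 4ℚ * a
      lem = solve 1 (λ a → a :+ con 3ℚ :* a := con 4ℚ :* a) refl

    -- `^-lipschitz` is used in both directions: the bases differ by at most 2, and `4ℚ * t` bounds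
    -- them both.
    floor-^ : ∀ j → ∣ ι (suc N) ^ suc j - t ^ suc j ∣ ≤ ι (suc j) * 2ℚ * (4ℚ * t) ^ j
    floor-^ j = ∣-∣≤
      (^-lipschitz j t≥0 t≤4t (ι-nonNeg (suc N)) 1+N≤4t (ι-nonNeg 2) N≤t+2)
      (^-lipschitz j (ι-nonNeg (suc N)) 1+N≤4t t≥0 t≤4t (ι-nonNeg 2) t≤N+3)
      where
      N≤t+2 : ι (suc N) ≤ t + 2ℚ
      N≤t+2 = subst (_≤ t + 2ℚ) (sym (ι-suc N)) (ℚ.+-mono-≤ N≤t (ι-mono {1} {2} (s≤s z≤n)))

    replace-floor : ∀ m c j → 0ℚ ≤ c → c ≤ 2ℚ →
      ∣ m - c * t ^ suc j ∣ ≤ ∣ m - c * ι (suc N) ^ suc j ∣ + 2ℚ * (ι (suc j) * 2ℚ * (4ℚ * t) ^ j)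
    replace-floor m c j c≥0 c≤2 = ℚ.≤-trans
      (∣-∣-triangle m (c * ι (suc N) ^ suc j) (c * t ^ suc j))
      (ℚ.+-monoʳ-≤ ∣ m - c * ι (suc N) ^ suc j ∣ (subst (_≤ 2ℚ * (ι (suc j) * 2ℚ * (4ℚ * t) ^ j)) (sym e)
        (*-mono {q = 2ℚ} c≥0 (*-nonNeg (*-nonNeg (ι-nonNeg (suc j)) (ι-nonNeg 2)) (^-nonNeg j (*-nonNeg (ι-nonNeg 4) t≥0)))
          c≤2 (floor-^ j))))
      where
      d = ι (suc N) ^ suc j - t ^ suc j
      lem : ∀ c a b → c * a - c * b ≡ c * (a - b)
      lem = solve 3 (λ c a b → c :* a :- c :* b := c :* (a :- b)) refl
      e : ∣ c * ι (suc N) ^ suc j - c * t ^ suc j ∣ ≡ c * ∣ d ∣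
      e = trans (cong ∣_∣ (lem c (ι (suc N) ^ suc j) (t ^ suc j)))
        (trans (ℚ.∣p*q∣≡∣p∣*∣q∣ c d) (cong (_* ∣ d ∣) (ℚ.0≤p⇒∣p∣≡p c≥0)))

  module _ (b j s : ℕ) (3≤b : 3 ℕ.≤ b) (bk≡ : b ℕ.* suc (suc j) ≡ suc s) (2≤s : 2 ℕ.≤ s) where

    private
      k = suc (suc j)
      A D : ℚ
      A = 4ℚ * (3ℚ * (ι k * 2ℚ))
      D = 2ℚ * (ι k * 2ℚ)

    -- `A` comes from the induction, `D` from replacing ⌊x⌋ by a term t of x in the main term, and
    -- the power of 4 from ⌊x⌋ ≤ 4t.
    constant-power : ℚ
    constant-power = (A + D) * 4ℚ ^ suc j

    rational-bound : ∀ {t N} → 1 ℕ.≤ N → ι N ≤ t → t ≤ ι (suc N) + 2ℚ → ∀ n → suc N ℕ.≤ n →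
      ∣ ι (M id b k (suc N)) - ζ-ratio s 2≤s n * t ^ k ∣ ≤ constant-power * ∣ t ^ suc j ∣
    rational-bound {t} {N} 1≤N N≤t t≤ n N≤n = begin
      ∣ ι (M id b k (suc N)) - c * t ^ k ∣
        ≤⟨ replace-floor 1≤N N≤t t≤ (ι (M id b k (suc N))) c (suc j) (ζ-ratio≥0 s 2≤s n) (ζ-ratio≤2 s 2≤s n) ⟩
      ∣ error b k c (suc N) ∣ + 2ℚ * (ι k * 2ℚ * T)
        ≤⟨ ℚ.+-monoˡ-≤ (2ℚ * (ι k * 2ℚ * T)) (ℚ.≤-trans
             (error-≤ b j s 3≤b bk≡ 2≤s n (suc N) N≤n)
             (*-monoʳ A≥0 (*-monoˡ (ℚ.<⇒≤ 0<1) (^-mono (suc j) (ι-nonNeg (suc N)) (1+N≤4t 1≤N N≤t t≤))))) ⟩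
      A * (T * 1ℚ) + 2ℚ * (ι k * 2ℚ * T)
        ≡⟨ lem A (ι k) T ⟩
      (A + D) * T
        ≡⟨ trans (cong ((A + D) *_) (^-distrib-* 4ℚ t (suc j))) (sym (ℚ.*-assoc (A + D) (4ℚ ^ suc j) (t ^ suc j))) ⟩
      constant-power * t ^ suc j
        ≤⟨ *-monoʳ (*-nonNeg (ℚ.≤-trans A≥0 (p≤p+q (*-nonNeg (ι-nonNeg 2) (*-nonNeg (ι-nonNeg k) (ι-nonNeg 2)))))
             (^-nonNeg (suc j) (ι-nonNeg 4))) (p≤∣p∣ (t ^ suc j)) ⟩
      constant-power * ∣ t ^ suc j ∣ ∎
      where
      open ℚ.≤-Reasoning
      c = ζ-ratio s 2≤s n
      T = (4ℚ * t) ^ suc j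
      A≥0 : 0ℚ ≤ A
      A≥0 = *-nonNeg (ι-nonNeg 4) (*-nonNeg (ι-nonNeg 3) (*-nonNeg (ι-nonNeg k) (ι-nonNeg 2)))
      lem : ∀ A K T → A * (T * 1ℚ) + 2ℚ * (K * 2ℚ * T) ≡ (A + 2ℚ * (K * 2ℚ)) * T
      lem = solve 3 (λ A K T → A :* (T :* con 1ℚ) :+ con 2ℚ :* (K :* con 2ℚ :* T) := (A :+ con 2ℚ :* (K :* con 2ℚ)) :* T) refl

  -- 32 = 24 + 8 adds the constant of `error₂₂-≤` and the cost of replacing the floor; 4 comes from
  -- ⌊x⌋ ≤ 4t and 7 from `1+harmonic-≤`.
  constant-log : ℚ
  constant-log = ι 32 * 4ℚ * ι 7

  rational-bound₂₂ : ∀ {t N} → 2 ℕ.≤ N → ι N ≤ t → t ≤ ι (suc N) + 2ℚ → ∀ n → suc N ℕ.≤ n →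
    ∣ ι (M id 2 2 (suc N)) - ζ-ratio 3 (s≤s (s≤s z≤n)) n * t ^ 2 ∣ ≤ constant-log * ∣ t * logSum n (0ℚ ℚ.⊔ (t - 1ℚ)) ∣
  rational-bound₂₂ {t} {N} 2≤N N≤t t≤ n N≤n = begin
    ∣ ι (M id 2 2 (suc N)) - c * t ^ 2 ∣
      ≤⟨ replace-floor 1≤N N≤t t≤ (ι (M id 2 2 (suc N))) c 1 (ζ-ratio≥0 3 2≤3 n) (ζ-ratio≤2 3 2≤3 n) ⟩
    ∣ error 2 2 c (suc N) ∣ + 2ℚ * (2ℚ * 2ℚ * (T * 1ℚ))
      ≤⟨ ℚ.+-mono-≤
           (ℚ.≤-trans (error₂₂-≤ n (suc N) N≤n)
             (*-monoʳ {r = 4ℚ * (3ℚ * 2ℚ)} (ι-nonNeg 24) (*-monoˡ {r = H} (1+harmonic≥0 (suc N)) (^-mono 1 (ι-nonNeg (suc N)) (1+N≤4t 1≤N N≤t t≤)))))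
           (*-monoʳ {r = 2ℚ} (ι-nonNeg 2) (*-monoʳ {r = 2ℚ * 2ℚ} (ι-nonNeg 4)
             (subst (_≤ T * 1ℚ * H) (ℚ.*-identityʳ (T * 1ℚ)) (*-monoʳ T1≥0 (p≤p+q (∑-≥0 (suc N) w≥0)))))) ⟩
    4ℚ * (3ℚ * 2ℚ) * (T * 1ℚ * H) + 2ℚ * (2ℚ * 2ℚ * (T * 1ℚ * H))
      ≡⟨ lem₁ t H ⟩
    ι 32 * 4ℚ * t * H
      ≤⟨ *-monoʳ (*-nonNeg {p = ι 32 * 4ℚ} (ι-nonNeg 128) t≥0′) (ℚ.≤-trans (1+harmonic-≤ N 2≤N) (*-monoʳ {r = ι 7} (ι-nonNeg 7) log≥)) ⟩
    ι 32 * 4ℚ * t * (ι 7 * ℓ)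
      ≡⟨ lem₂ t ℓ ⟩
    constant-log * (t * ℓ)
      ≤⟨ *-monoʳ {r = constant-log} (ι-nonNeg 896) (p≤∣p∣ (t * ℓ)) ⟩
    constant-log * ∣ t * ℓ ∣ ∎
    where
    open ℚ.≤-Reasoning
    2≤3 = s≤s (s≤s z≤n)
    1≤N : 1 ℕ.≤ N
    1≤N = ℕ.≤-trans (ℕ.n≤1+n 1) 2≤N
    t≥0′ = t≥0 1≤N N≤t t≤
    c = ζ-ratio 3 2≤3 n
    T = 4ℚ * t
    T1≥0 : 0ℚ ≤ T * 1ℚ
    T1≥0 = *-nonNeg (*-nonNeg (ι-nonNeg 4) t≥0′) (ℚ.<⇒≤ 0<1)
    H = 1ℚ + harmonic (suc N)
    u = 0ℚ ℚ.⊔ (t - 1ℚ)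
    ℓ = logSum n u
    log≥ : harmonic N - 1ℚ ≤ ℓ
    log≥ = logSum-≥ 1≤N n (ℚ.p≤p⊔q 0ℚ (t - 1ℚ)) (ℚ.≤-trans N≤t
      (subst (_≤ 1ℚ + u) (lem t) (ℚ.+-monoʳ-≤ 1ℚ (ℚ.p≤q⊔p 0ℚ (t - 1ℚ)))))
      where
      lem : ∀ t → 1ℚ + (t - 1ℚ) ≡ t
      lem = solve 1 (λ t → con 1ℚ :+ (t :- con 1ℚ) := t) refl
    lem₁ : ∀ t H → 4ℚ * (3ℚ * 2ℚ) * (4ℚ * t * 1ℚ * H) + 2ℚ * (2ℚ * 2ℚ * (4ℚ * t * 1ℚ * H)) ≡ ι 32 * 4ℚ * t * H
    lem₁ = solve 2 (λ t H → con 4ℚ :* (con 3ℚ :* con 2ℚ) :* (con 4ℚ :* t :* con 1ℚ :* H)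
                 :+ con 2ℚ :* (con 2ℚ :* con 2ℚ :* (con 4ℚ :* t :* con 1ℚ :* H)) := con (ι 32) :* con 4ℚ :* t :* H) refl
    lem₂ : ∀ t l → ι 32 * 4ℚ * t * (ι 7 * l) ≡ ι 32 * 4ℚ * ι 7 * (t * l)
    lem₂ = solve 2 (λ t l → con (ι 32) :* con 4ℚ :* t :* (con (ι 7) :* l) := con (ι 32) :* con 4ℚ :* con (ι 7) :* (t :* l)) refl

  -- x₀ = 3 makes N = ⌊x⌋ ≥ 3, so that the lower bound harmonic (N - 1) - 1 of log x is positive.
  asymptotics : ∀ (S : ℕ → ℕ) (F G : ℝ → ℝ) (C : ℚ) →
    (∀ x N n → 2 ℕ.≤ N → ι N ≤ seq x n → seq x n ≤ ι (suc N) + 2ℚ → suc N ℕ.≤ n →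
      ∣ ι (S (suc N)) - seq (F x) n ∣ ≤ C * ∣ seq (G x) n ∣) →
    S ∘floor≈ F +O G
  asymptotics S F G C bound = fromℚ C , fromℕ 3 , λ x N floor 3≤x → close x N floor (Equivalence.from (floor 3) 3≤x)
    where
    close : ∀ x N → N IsFloorOf x → 3 ℕ.≤ N →
      Defs.∣ fromℕ (S N) Defs.- F x ∣ Defs.≤ (fromℚ C Defs.* Defs.∣ G x ∣)
    close x (suc N) floor (s≤s 2≤N) ε ε>0 = proj₁ bounds , λ n n≥ →
      let N≤n , N≤x , x≤ = proj₂ bounds n n≥ in
      ℚ.≤-trans (bound x N n 2≤N N≤x x≤ N≤n) (p≤p+q (ℚ.<⇒≤ ε>0))
      where
      bounds = floor-bounds {x} {N} floor

-- The two asymptotic formulas for real x.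

open import Defs
open import Data.Nat using (ℕ; suc; _∸_; s≤s; z≤n; nonTrivial⇒n>1) renaming (_≤_ to _≤ⁿ_; _*_ to _*ⁿ_)
import Data.Nat.Properties as ℕ
open import Data.Product using (_×_; _,_)
import Data.Rational as ℚ
open import Function using (id)
open import Relation.Binary.PropositionalEquality using (refl; sym; subst₂)

theorem1p6 :
    (M id 2 2 ∘floor≈ (λ x → ζ 3 /ζ 4 * x ^ 2) +O (λ x → x * log x))
    ×
    ((b k : ℕ) → (3≤b : 3 ≤ⁿ b) → (2≤k : 2 ≤ⁿ k) →
      let instance
            _ = bk∸1-nonTrivial 3≤b 2≤k
            _ = bk-nonTrivial 3≤b 2≤k
      in M id b k ∘floor≈ (λ x → ζ (b *ⁿ k ∸ 1) /ζ (b *ⁿ k) * x ^ k) +O (λ x → x ^ (k ∸ 1)))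
theorem1p6 = b=k=2 , general
  where
  open Recursion using (ζ-ratio)
  open Transfer

  b=k=2 : M id 2 2 ∘floor≈ (λ x → ζ 3 /ζ 4 * x ^ 2) +O (λ x → x * log x)
  b=k=2 = asymptotics (M id 2 2) (λ x → ζ 3 /ζ 4 * x ^ 2) (λ x → x * log x) constant-log (λ x N n 2≤N N≤x x≤ N≤n →
    rational-bound₂₂ 2≤N N≤x x≤ n N≤n)

  general : (b k : ℕ) → (3≤b : 3 ≤ⁿ b) → (2≤k : 2 ≤ⁿ k) →
    let instance
          _ = bk∸1-nonTrivial 3≤b 2≤k
          _ = bk-nonTrivial 3≤b 2≤k
    in M id b k ∘floor≈ (λ x → ζ (b *ⁿ k ∸ 1) /ζ (b *ⁿ k) * x ^ k) +O (λ x → x ^ (k ∸ 1))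
  -- With `b` and `k` exposed as successors, `b *ⁿ k` reduces to a successor, so `refl` proves that
  -- it equals `suc s`.
  general b@(suc b′) k@(suc (suc j)) 3≤b@(s≤s _) 2≤k@(s≤s (s≤s z≤n)) =
    asymptotics (M id b k) (λ x → ζ s /ζ (b *ⁿ k) * x ^ k) (λ x → x ^ suc j) C (λ x N n 2≤N N≤x x≤ N≤n →
      -- For a variable exponent the terms of a real power do not compute to rational powers, so
      -- `seq-^` has to rewrite them.
      subst₂ (λ p q → ℚ.∣ Rational.ι (M id b k (suc N)) ℚ.- ζ-ratio s 2≤s n ℚ.* p ∣ ℚ.≤ C ℚ.* ℚ.∣ q ∣)
        (sym (seq-^ x k n)) (sym (seq-^ x (suc j) n))
        (rational-bound b j s 3≤b refl 2≤s (ℕ.≤-trans (s≤s z≤n) 2≤N) N≤x x≤ n N≤n))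
    where
    s = b *ⁿ k ∸ 1
    instance
      _ = bk∸1-nonTrivial 3≤b 2≤k
      _ = bk-nonTrivial 3≤b 2≤k
    2≤s : 2 ≤ⁿ s
    2≤s = nonTrivial⇒n>1 s {{bk∸1-nonTrivial 3≤b 2≤k}}
    C = constant-power b j s 3≤b refl 2≤s
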